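{- Let $\mathcal{G}$ and $\mathcal{H}$ be game models over state spaces $S$ and $T$ that are closed under the Souslin operation, let $f:\mathcal{G}\to\mathcal{H}$ be a model morphism, and let $\varphi$ be a formula of game logic. Then for every state $s\in S$: $$\mathcal{G},s\models\varphi\quad\text{iff}\quad\mathcal{H},f(s)\models\varphi.$$
   Context: A measurable space $S$ has a $\sigma$-algebra $\mathcal{B}(S)$; $[0,1]$ carries its Borel sets; $S\otimes T$ is the product space. $\mathrm{Sub}(S)$ is the set of subprobability measures on $S$ with the smallest $\sigma$-algebra making all $\mu\mapsto\mu(A)$, $A\in\mathcal{B}(S)$, measurable. For measurable $f:S\to T$, $\mathrm{Sub}(f)(\mu)(B):=\mu(f^{ -1}[B])$. $\boldsymbol\beta(A,>q):=\{\mu\in\mathrm{Sub}(S)\mid\mu(A)>q\}$. $\mathcal{V}(S)$ is the set of all upward closed $V\subseteq\mathcal{B}(\mathrm{Sub}(S))$. $P:S\to\mathcal{V}(S)$ is t-measurable iff $\{\langle s,q\rangle\in S\times[0,1]\mid H_q\in P(s)\}\in\mathcal{B}(S\otimes[0,1])$ for every $H\in\mathcal{B}(\mathrm{Sub}(S)\otimes[0,1])$, where $H_q:=\{\mu\mid\langle\mu,q\rangle\in H\}$; a stochastic effectivity function on $S$ is a t-measurable map $S\to\mathcal{V}(S)$. A morphism $f:P\to Q$ of stochastic effectivity functions $P$ on $S$, $Q$ on $T$ is a measurable $f:S\to T$ with $W\in Q(f(s))\Leftrightarrow\mathrm{Sub}(f)^{ -1}[W]\in P(s)$ for all $s\in S$,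 $W\in\mathcal{B}(\mathrm{Sub}(T))$. $S$ is closed under the Souslin operation iff $\bigcup_{\alpha\in\mathbb{N}^{\mathbb{N}}}\bigcap_{n\in\mathbb{N}}A_{\alpha|n}\in\mathcal{B}(S)$ for every family $(A_v)$ in $\mathcal{B}(S)$ indexed by finite words $v$ over $\mathbb{N}$ ($\alpha|n$ = first $n$ letters of $\alpha$). Games: $\Gamma$ is the set of primitive games, containing the empty game $\epsilon$. Games: $\tau::=\gamma\mid\tau^d\mid\tau_1\cup\tau_2\mid\tau_1\cap\tau_2\mid\tau_1;\tau_2\mid\tau^*\mid\tau^\times$, $\gamma\in\Gamma$, identified according to: $(\tau^d)^d=\tau$; $\tau_1\cap\tau_2=(\tau_1^d\cup\tau_2^d)^d$; $(\tau^\times)^d=(\tau^d)^*$; $(\tau_1\cup\tau_2);\tau=\tau_1;\tau\cup\tau_2;\tau$; $(\tau_1;\tau_2)^d=\tau_1^d;\tau_2^d$; $\cup,\cap$ commutative and associative, $;$ associative; $\tau^*;\tau_0$ expands to $\tau_0\cup\tau;\tau_0\cup\tau;\tau;\tau_0\cup\dots$. A game frame $(S,(P_\gamma)_{\gamma\in\Gamma})$ has a measurable space $S$ and stochastic effectivity functions $P_\gamma$ on $S$, with $P_\epsilon(s)=\{W\mid\delta_s\in W\}$. With $Q^{(k)}(q):=\{\langle a_1,\dots,a_k\rangle\in\mathbb{Q}^k\mid a_i\geq0,\sum_ia_i\leq q\}$ ($0\leq k\leq\infty$), for $A\in\mathcal{B}(S)$, $q\geq0$ define recursively, modulo the identifications: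 (A) $\mathfrak{I}_{\mathcal{G}}(\gamma\mid A,q):=\{s\mid\boldsymbol\beta(A,>q)\in P_\gamma(s)\}$, $\gamma\in\Gamma$; (B) $\mathfrak{I}_{\mathcal{G}}(\tau^d\mid A,q):=S\setminus\mathfrak{I}_{\mathcal{G}}(\tau\mid S\setminus A,q)$; (C) $\mathfrak{I}_{\mathcal{G}}(\tau_1\cup\tau_2\mid A,q):=\bigcap_{a\in Q^{(2)}(q)}(\mathfrak{I}_{\mathcal{G}}(\tau_1\mid A,a_1)\cup\mathfrak{I}_{\mathcal{G}}(\tau_2\mid A,a_2))$; (D) $\mathfrak{I}_{\mathcal{G}}((\tau_1\cup\tau_2);\tau\mid A,q):=\mathfrak{I}_{\mathcal{G}}(\tau_1;\tau\cup\tau_2;\tau\mid A,q)$; (E) $\mathfrak{I}_{\mathcal{G}}(\gamma;\tau\mid A,q):=\{s\mid G_\tau(A,q)\in P_\gamma(s)\}$, $\gamma\in\Gamma$, with $G_\tau(A,q):=\{\mu\in\mathrm{Sub}(S)\mid\int_0^1\mu(\mathfrak{I}_{\mathcal{G}}(\tau\mid A,r))\,dr>q\}$; (F) $\mathfrak{I}_{\mathcal{G}}(\tau^*;\tau_0\mid A,q):=\bigcap_{a\in Q^{(\infty)}(q)}\bigcup_{n\geq0}\mathfrak{I}_{\mathcal{G}}(\tau^n;\tau_0\mid A,a_{n+1})$, with $\tau^n=\tau;\dots;\tau$ ($n$ times), $\tau^0;\tau_0=\tau_0$; bare $\tau^*$ is read as $\tau^*;\epsilon$. Game logic: formulas $\varphi::=\top\mid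 p\mid\varphi_1\wedge\varphi_2\mid\langle\tau\rangle_q\varphi$ with $p\in\Psi$ atomic propositions, $\tau$ a game, $q\in[0,1]$. A game model $\mathcal{G}=(S,(P_\gamma)_{\gamma\in\Gamma},(V_p)_{p\in\Psi})$ is a game frame together with sets $V_p\in\mathcal{B}(S)$. Validity sets: $[\![\top]\!]_{\mathcal{G}}=S$, $[\![p]\!]_{\mathcal{G}}=V_p$, $[\![\varphi_1\wedge\varphi_2]\!]_{\mathcal{G}}=[\![\varphi_1]\!]_{\mathcal{G}}\cap[\![\varphi_2]\!]_{\mathcal{G}}$, $[\![\langle\tau\rangle_q\varphi]\!]_{\mathcal{G}}=\mathfrak{I}_{\mathcal{G}}(\tau\mid[\![\varphi]\!]_{\mathcal{G}},q)$; $\mathcal{G},s\models\varphi$ iff $s\in[\![\varphi]\!]_{\mathcal{G}}$. A model morphism $f:(S,(P_\gamma),(V_p))\to(T,(Q_\gamma),(W_p))$ is a measurable $f:S\to T$ such that $f:P_\gamma\to Q_\gamma$ is a morphism for every $\gamma\in\Gamma$ and $f^{ -1}[W_p]=V_p$ for every $p\in\Psi$. -}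

module Defs where

open import Axiom.ExcludedMiddle using (ExcludedMiddle)
open import Data.Empty using (⊥-elim)
open import Data.List.Base using (List; []; _∷_; applyUpTo)
open import Data.Nat.Base as ℕ using (ℕ)
import Data.Nat.Properties as ℕ
open import Data.Nat.GeneralisedArithmetic using (fold)
open import Data.Product.Base using (Σ; ∃; ∃₂; _×_; _,_; proj₁; proj₂)
open import Data.Rational.Base as ℚ using (ℚ; 0ℚ; 1ℚ)
import Data.Rational.Properties as ℚ
open import Data.Sum.Base as Sum using (_⊎_; inj₁; inj₂)
open import Function.Base using (_∘_; id)
open import Function.Bundles using (_⇔_; mk⇔; Equivalence)
open import Level using (Level; _⊔_; 0ℓ; Lift; lift; lower) renaming (suc to lsuc)
open import Relation.Binary.Definitions using (tri<; tri≈; tri>)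
open import Relation.Binary.PropositionalEquality
  using (_≡_; _≢_; refl; sym; trans; cong; subst)
open import Relation.Nullary using (¬_; yes; no)
open import Relation.Nullary.Decidable using (decidable-stable)
open import Relation.Unary using (Pred; _∈_; _⊆_; _⊆′_; _≐_; ∁; _∩_; _∪_; _⊢_; _⟨×⟩_; ⋃)
open import Relation.Unary.Polymorphic using (∅; U)

------------------------------------------------------------------------
-- Real numbers

-- A real number is a Dedekind cut, given by its set of strictly smaller
-- rationals.  Cuts take values in Set ℓ, so a subset {μ ∣ p < μ(A)} lives at
-- the same level as the subsets A themselves.

record ℝ (ℓ : Level) : Set (lsuc ℓ) where
  field
    cut       : Pred ℚ ℓ
    inhabited : ∃ λ p → p ∈ cut
    bounded   : ∃ λ p → ¬ (p ∈ cut)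
    down      : ∀ {p q} → p ℚ.< q → q ∈ cut → p ∈ cut
    rounded   : ∀ {p} → p ∈ cut → ∃ λ q → p ℚ.< q × q ∈ cut

open ℝ public using (cut)

infix 4 _≤ᴿ_ _<ᴿ_ _≃ᴿ_
infixl 6 _+ᴿ_

_≤ᴿ_ : ∀ {ℓ} → ℝ ℓ → ℝ ℓ → Set ℓ
x ≤ᴿ y = cut x ⊆′ cut y

_<ᴿ_ : ∀ {ℓ} → ℝ ℓ → ℝ ℓ → Set ℓ
x <ᴿ y = ∃ λ p → p ∈ cut y × ¬ (p ∈ cut x)

_≃ᴿ_ : ∀ {ℓ} → ℝ ℓ → ℝ ℓ → Set ℓ
x ≃ᴿ y = x ≤ᴿ y × y ≤ᴿ x

private
  -1<0 : ℚ.- 1ℚ ℚ.< 0ℚ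
  -1<0 = ℚ.neg-antimono-< (ℚ.positive⁻¹ 1ℚ)

  p-1<p : ∀ p → p ℚ.+ ℚ.- 1ℚ ℚ.< p
  p-1<p p = subst (p ℚ.+ ℚ.- 1ℚ ℚ.<_) (ℚ.+-identityʳ p) (ℚ.+-monoʳ-< p -1<0)

  below-bound : ∀ {ℓ} (x : ℝ ℓ) {a u} → a ∈ cut x → ¬ (u ∈ cut x) → a ℚ.< u
  below-bound x {a} {u} a∈x u∉x with ℚ.<-cmp a u
  ... | tri< a<u _ _  = a<u
  ... | tri≈ _ refl _ = ⊥-elim (u∉x a∈x)
  ... | tri> _ _ u<a  = ⊥-elim (u∉x (ℝ.down x u<a a∈x))

fromℚ : ∀ {ℓ} → ℚ → ℝ ℓ
fromℚ {ℓ} q = record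
  { cut       = λ p → Lift ℓ (p ℚ.< q)
  ; inhabited = q ℚ.+ ℚ.- 1ℚ , lift (p-1<p q)
  ; bounded   = q , λ (lift q<q) → ℚ.<-irrefl refl q<q
  ; down      = λ p<r (lift r<q) → lift (ℚ.<-trans p<r r<q)
  ; rounded   = λ (lift p<q) →
      let r , p<r , r<q = ℚ.<-dense p<q in r , p<r , lift r<q
  }

_+ᴿ_ : ∀ {ℓ} → ℝ ℓ → ℝ ℓ → ℝ ℓ
_+ᴿ_ {ℓ} x y = record
  { cut       = λ p → ∃₂ λ a b → a ∈ cut x × b ∈ cut y × p ℚ.< a ℚ.+ b
  ; inhabited =
      let a , a∈x = ℝ.inhabited x
          b , b∈y = ℝ.inhabited y
      in a ℚ.+ b ℚ.+ ℚ.- 1ℚ , a , b , a∈x , b∈y , p-1<p (a ℚ.+ b)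
  ; bounded   =
      let u , u∉x = ℝ.bounded x
          v , v∉y = ℝ.bounded y
      in u ℚ.+ v , λ (a , b , a∈x , b∈y , u+v<a+b) →
           ℚ.<-irrefl refl (ℚ.<-trans u+v<a+b
             (ℚ.+-mono-< (below-bound x a∈x u∉x) (below-bound y b∈y v∉y)))
  ; down      = λ p<q (a , b , a∈x , b∈y , q<a+b) →
      a , b , a∈x , b∈y , ℚ.<-trans p<q q<a+b
  ; rounded   = λ (a , b , a∈x , b∈y , p<a+b) →
      let q , p<q , q<a+b = ℚ.<-dense p<a+b
      in q , p<q , a , b , a∈x , b∈y , q<a+b
  }

∑ : ∀ {ℓ} → ℕ → (ℕ → ℝ ℓ) → ℝ ℓ
∑ ℕ.zero    x = fromℚ 0ℚ
∑ (ℕ.suc n) x = ∑ n x +ᴿ x n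

IsSupremum : ∀ {ℓ} → (ℕ → ℝ ℓ) → ℝ ℓ → Set (lsuc ℓ)
IsSupremum x s = (∀ n → x n ≤ᴿ s) × (∀ u → (∀ n → x n ≤ᴿ u) → s ≤ᴿ u)

record 𝕀 (ℓ : Level) : Set (lsuc ℓ) where
  constructor _[_,_]
  field
    value : ℝ ℓ
    0≤    : fromℚ 0ℚ ≤ᴿ value
    ≤1    : value ≤ᴿ fromℚ 1ℚ

open 𝕀 public using (value)

------------------------------------------------------------------------
-- Measurable spaces

-- Subsets are predicates with values in Set ℓ, identified up to _≐_.

record MeasurableSpace (c ℓ : Level) : Set (lsuc (c ⊔ lsuc ℓ)) where
  field
    Carrier : Set c
    𝓑       : Pred (Pred Carrier ℓ) (c ⊔ lsuc ℓ)
    resp    : ∀ {A B} → A ≐ B → A ∈ 𝓑 → B ∈ 𝓑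
    empty   : ∅ ∈ 𝓑
    compl   : ∀ {A} → A ∈ 𝓑 → ∁ A ∈ 𝓑
    union   : ∀ {A : ℕ → Pred Carrier ℓ} → (∀ n → A n ∈ 𝓑) → ⋃ ℕ A ∈ 𝓑

open MeasurableSpace public using (Carrier; 𝓑)

-- The smallest σ-algebra containing 𝓔.
data σ {c ℓ} {X : Set c} (𝓔 : Pred (Pred X ℓ) (c ⊔ lsuc ℓ)) :
       Pred (Pred X ℓ) (c ⊔ lsuc ℓ) where
  basic : ∀ {A} → A ∈ 𝓔 → A ∈ σ 𝓔
  resp  : ∀ {A B} → A ≐ B → A ∈ σ 𝓔 → B ∈ σ 𝓔
  empty : ∅ ∈ σ 𝓔
  compl : ∀ {A} → A ∈ σ 𝓔 → ∁ A ∈ σ 𝓔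
  union : ∀ {A : ℕ → Pred X ℓ} → (∀ n → A n ∈ σ 𝓔) → ⋃ ℕ A ∈ σ 𝓔

generated : ∀ {c ℓ} {X : Set c} → Pred (Pred X ℓ) (c ⊔ lsuc ℓ) → MeasurableSpace c ℓ
generated {X = X} 𝓔 = record
  { Carrier = X
  ; 𝓑       = σ 𝓔
  ; resp    = resp
  ; empty   = empty
  ; compl   = compl
  ; union   = union
  }

Measurable : ∀ {c d ℓ} (S : MeasurableSpace c ℓ) (T : MeasurableSpace d ℓ) →
             (Carrier S → Carrier T) → Set (c ⊔ d ⊔ lsuc ℓ)
Measurable S T f = ∀ {B} → B ∈ 𝓑 T → (f ⊢ B) ∈ 𝓑 S

infixr 7 _⊗_

_⊗_ : ∀ {c d k ℓ} → MeasurableSpace c k → MeasurableSpace d ℓ →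
      MeasurableSpace (c ⊔ d) (k ⊔ ℓ)
S ⊗ T = generated {X = Carrier S × Carrier T} λ R →
  ∃₂ λ A B → A ∈ 𝓑 S × B ∈ 𝓑 T × R ≐ (A ⟨×⟩ B)

IsOpen : ∀ {ℓ} → Pred (𝕀 ℓ) ℓ → Set (lsuc ℓ)
IsOpen {ℓ} V = ∀ x → x ∈ V → ∃₂ λ p q →
  (fromℚ p <ᴿ value x × value x <ᴿ fromℚ q) ×
  (∀ y → fromℚ p <ᴿ value y → value y <ᴿ fromℚ q → y ∈ V)

[0,1] : ∀ ℓ → MeasurableSpace (lsuc ℓ) ℓ
[0,1] ℓ = generated IsOpen

-- applyUpTo α n = α 0 ∷ … ∷ α (n ∸ 1) ∷ [] is the word α|n.
SouslinClosed : ∀ {c ℓ} → MeasurableSpace c ℓ → Set (c ⊔ lsuc ℓ)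
SouslinClosed S = (A : List ℕ → Pred (Carrier S) _) → (∀ v → A v ∈ 𝓑 S) →
  (λ s → ∃ λ (α : ℕ → ℕ) → ∀ n → s ∈ A (applyUpTo α n)) ∈ 𝓑 S

------------------------------------------------------------------------
-- Subprobability measures

-- A measure takes a measurable set together with the proof of its
-- measurability; extensionality makes the value independent of that proof.
record Subprobability {c ℓ} (S : MeasurableSpace c ℓ) : Set (c ⊔ lsuc ℓ) where
  field
    measure  : (A : Pred (Carrier S) ℓ) → A ∈ 𝓑 S → 𝕀 ℓ
    ext      : ∀ {A B} (mA : A ∈ 𝓑 S) (mB : B ∈ 𝓑 S) → A ≐ B →
               value (measure A mA) ≃ᴿ value (measure B mB)
    null     : value (measure ∅ (MeasurableSpace.empty S)) ≃ᴿ fromℚ 0ℚ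
    additive : (A : ℕ → Pred (Carrier S) ℓ) (mA : ∀ n → A n ∈ 𝓑 S) →
               (∀ {i j} → i ≢ j → ∀ {x} → x ∈ A i → ¬ (x ∈ A j)) →
               IsSupremum (λ n → ∑ n λ i → value (measure (A i) (mA i)))
                          (value (measure (⋃ ℕ A) (MeasurableSpace.union S mA)))

open Subprobability public using (measure)

-- Subsets of Sub(S) sit at level c ⊔ lsuc ℓ, since the sets occurring in the
-- interpretation of games quantify over all reals in [0,1].
data Evaluation {c ℓ} (S : MeasurableSpace c ℓ) :
     Pred (Pred (Subprobability S) (c ⊔ lsuc ℓ)) (lsuc (c ⊔ lsuc ℓ)) where
  evaluation : ∀ {W A B} (mA : A ∈ 𝓑 S) → B ∈ 𝓑 ([0,1] ℓ) →
               W ≐ (λ μ → measure μ A mA ∈ B) → W ∈ Evaluation S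

Sub : ∀ {c ℓ} → MeasurableSpace c ℓ → MeasurableSpace (c ⊔ lsuc ℓ) (c ⊔ lsuc ℓ)
Sub S = generated (Evaluation S)

Sub-map : ∀ {c ℓ} {S T : MeasurableSpace c ℓ} (f : Carrier S → Carrier T) →
          Measurable S T f → Subprobability S → Subprobability T
Sub-map {S = S} f mf μ = record
  { measure  = λ B mB → measure μ (f ⊢ B) (mf mB)
  ; ext      = λ mA mB A≐B → ext (mf mA) (mf mB) (proj₁ A≐B , proj₂ A≐B)
  ; null     =
      let ≤∅ , ∅≤ = ext (mf _) (MeasurableSpace.empty S) (id , id)
      in (λ p → proj₁ null p ∘ ≤∅ p) , (λ p → ∅≤ p ∘ proj₂ null p)
  ; additive = λ B mB disj →
      let ub , least = additive (λ n → f ⊢ B n) (λ n → mf (mB n)) (λ i≢j → disj i≢j)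
          ≤⋃ , ⋃≤    = ext (MeasurableSpace.union S λ n → mf (mB n)) (mf _) (id , id)
      in (λ n p → ≤⋃ p ∘ ub n p) , λ u x≤u p → least u x≤u p ∘ ⋃≤ p
  }
  where open Subprobability μ using (ext; null; additive)

module _ {c ℓ : Level} {S : MeasurableSpace c ℓ} where

  private
    value-δ : Carrier S → Pred (Carrier S) ℓ → ℝ ℓ
    value-δ s A = record
      { cut       = λ p → p ℚ.< 0ℚ ⊎ (s ∈ A × p ℚ.< 1ℚ)
      ; inhabited = ℚ.- 1ℚ , inj₁ -1<0
      ; bounded   = 1ℚ , λ where
          (inj₁ 1<0)       → ℚ.<-irrefl refl (ℚ.<-trans 1<0 (ℚ.positive⁻¹ 1ℚ))
          (inj₂ (_ , 1<1)) → ℚ.<-irrefl refl 1<1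
      ; down      = λ where
          p<q (inj₁ q<0)         → inj₁ (ℚ.<-trans p<q q<0)
          p<q (inj₂ (s∈A , q<1)) → inj₂ (s∈A , ℚ.<-trans p<q q<1)
      ; rounded   = λ where
          (inj₁ p<0)         → let q , p<q , q<0 = ℚ.<-dense p<0 in q , p<q , inj₁ q<0
          (inj₂ (s∈A , p<1)) →
            let q , p<q , q<1 = ℚ.<-dense p<1 in q , p<q , inj₂ (s∈A , q<1)
      }

    0≤δ : ∀ s A → fromℚ 0ℚ ≤ᴿ value-δ s A
    0≤δ s A _ (lift p<0) = inj₁ p<0

    δ≤1 : ∀ s A → value-δ s A ≤ᴿ fromℚ 1ℚ
    δ≤1 s A _ (inj₁ p<0)       = lift (ℚ.<-trans p<0 (ℚ.positive⁻¹ 1ℚ))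
    δ≤1 s A _ (inj₂ (_ , p<1)) = lift p<1

    module _ (s : Carrier S) (A : ℕ → Pred (Carrier S) ℓ)
             (disj : ∀ {i j} → i ≢ j → ∀ {x} → x ∈ A i → ¬ (x ∈ A j)) where

      ∑δ-upper : ∀ n {p} → p ∈ cut (∑ n λ i → value-δ s (A i)) →
                 p ℚ.< 0ℚ ⊎ (∃ λ i → i ℕ.< n × s ∈ A i) × p ℚ.< 1ℚ
      ∑δ-upper ℕ.zero    (lift p<0) = inj₁ p<0
      ∑δ-upper (ℕ.suc n) (a , b , a∈ , b∈ , p<a+b) with ∑δ-upper n a∈ | b∈
      ... | inj₁ a<0 | inj₁ b<0 = inj₁ (ℚ.<-trans p<a+b (ℚ.+-mono-< a<0 b<0))
      ... | inj₁ a<0 | inj₂ (s∈ , b<1) =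
        inj₂ ((n , ℕ.n<1+n n , s∈) , ℚ.<-trans p<a+b (ℚ.+-mono-< a<0 b<1))
      ... | inj₂ ((i , i<n , s∈) , a<1) | inj₁ b<0 =
        inj₂ ((i , ℕ.m<n⇒m<1+n i<n , s∈) , ℚ.<-trans p<a+b (ℚ.+-mono-< a<1 b<0))
      ... | inj₂ ((i , i<n , s∈Aᵢ) , _) | inj₂ (s∈Aₙ , _) =
        ⊥-elim (disj (ℕ.<⇒≢ i<n) s∈Aᵢ s∈Aₙ)

      ∑δ-nonneg : ∀ n {p} → p ℚ.< 0ℚ → p ∈ cut (∑ n λ i → value-δ s (A i))
      ∑δ-nonneg ℕ.zero    p<0 = lift p<0
      ∑δ-nonneg (ℕ.suc n) {p} p<0 =
        let q , p<q , q<0 = ℚ.<-dense p<0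
            d , p-q<d , d<0 = ℚ.<-dense (p-q<0 p<q)
        in q , d , ∑δ-nonneg n q<0 , inj₁ d<0 ,
           subst (ℚ._< q ℚ.+ d) (q+[p-q] q p) (ℚ.+-monoʳ-< q p-q<d)
        where
        q+[p-q] : ∀ q p → q ℚ.+ (p ℚ.- q) ≡ p
        q+[p-q] q p = trans (cong (q ℚ.+_) (ℚ.+-comm p (ℚ.- q)))
          (trans (sym (ℚ.+-assoc q (ℚ.- q) p))
            (trans (cong (ℚ._+ p) (ℚ.+-inverseʳ q)) (ℚ.+-identityˡ p)))
        p-q<0 : ∀ {q} → p ℚ.< q → p ℚ.- q ℚ.< 0ℚ
        p-q<0 {q} p<q = subst (p ℚ.- q ℚ.<_) (ℚ.+-inverseʳ q) (ℚ.+-monoˡ-< (ℚ.- q) p<q)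

      ∑δ-lower : ∀ n → s ∈ A n → ∀ {p} → p ℚ.< 1ℚ →
                 p ∈ cut (∑ (ℕ.suc n) λ i → value-δ s (A i))
      ∑δ-lower n s∈ {p} p<1 =
        let q , p<q , q<1 = ℚ.<-dense p<1
            d , p-q<d , d<0 = ℚ.<-dense
              (subst (p ℚ.- q ℚ.<_) (ℚ.+-inverseʳ q) (ℚ.+-monoˡ-< (ℚ.- q) p<q))
        in d , q , ∑δ-nonneg n d<0 , inj₂ (s∈ , q<1) ,
           subst (ℚ._< d ℚ.+ q) ([p-q]+q q) (ℚ.+-monoˡ-< q p-q<d)
        where
        [p-q]+q : ∀ q → p ℚ.- q ℚ.+ q ≡ p
        [p-q]+q q = trans (ℚ.+-assoc p (ℚ.- q) q)
          (trans (cong (p ℚ.+_) (ℚ.+-inverseˡ q)) (ℚ.+-identityʳ p))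

  δ : Carrier S → Subprobability S
  δ s = record
    { measure  = λ A _ → value-δ s A [ 0≤δ s A , δ≤1 s A ]
    ; ext      = λ where
        _ _ (A⊆B , B⊆A) → (λ _ → Sum.map id λ (s∈A , p<1) → A⊆B s∈A , p<1) ,
                          (λ _ → Sum.map id λ (s∈B , p<1) → B⊆A s∈B , p<1)
    ; null     = (λ { _ (inj₁ p<0) → lift p<0 ; _ (inj₂ (() , _)) }) , 0≤δ s ∅
    ; additive = λ A _ disj →
        (λ n _ p∈ → bound A (∑δ-upper s A disj n p∈)) ,
        λ { u ≤u _ (inj₁ p<0) → ≤u 0 _ (lift p<0)
          ; u ≤u _ (inj₂ ((n , s∈) , p<1)) → ≤u (ℕ.suc n) _ (∑δ-lower s A disj n s∈ p<1) }
    }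
    where
    bound : ∀ A {n p} → p ℚ.< 0ℚ ⊎ (∃ λ i → i ℕ.< n × s ∈ A i) × p ℚ.< 1ℚ →
            p ∈ cut (value-δ s (⋃ ℕ A))
    bound A (inj₁ p<0)                   = inj₁ p<0
    bound A (inj₂ ((i , _ , s∈) , p<1)) = inj₂ ((i , s∈) , p<1)

-- The condition A ∈ 𝓑(S) is part of membership in 𝜷, so that A may be any
-- subset; for measurable A this is {μ ∣ μ(A) > q}.
𝜷 : ∀ {c ℓ} (S : MeasurableSpace c ℓ) → Pred (Carrier S) ℓ → ℝ ℓ →
    Pred (Subprobability S) (c ⊔ lsuc ℓ)
𝜷 S A q μ = Σ (A ∈ 𝓑 S) λ mA → q <ᴿ value (measure μ A mA)

------------------------------------------------------------------------
-- The integral ∫₀¹ g(r) dr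

-- A list (x₁ , h₁) ∷ … ∷ (xₙ , hₙ) ∷ [] together with a starting point x₀
-- describes the step function with value hᵢ on [xᵢ₋₁ , xᵢ].  It lies below g on
-- [x₀ , 1] if xₙ = 1 and hᵢ ≤ g(r) for all r ∈ [xᵢ₋₁ , xᵢ].
StepBelow : ∀ {ℓ} → (𝕀 ℓ → 𝕀 ℓ) → ℚ → List (ℚ × ℚ) → Set (lsuc ℓ)
StepBelow {ℓ} g a []            = Lift (lsuc ℓ) (a ≡ 1ℚ)
StepBelow     g a ((b , h) ∷ π) =
  a ℚ.≤ b ×
  (∀ r → fromℚ a ≤ᴿ value r → value r ≤ᴿ fromℚ b → fromℚ h ≤ᴿ value (g r)) ×
  StepBelow g b π

area : ℚ → List (ℚ × ℚ) → ℚ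
area a []            = 0ℚ
area a ((b , h) ∷ π) = (b ℚ.- a) ℚ.* h ℚ.+ area b π

-- q < ∫₀¹ g(r) dr, with the integral taken as the supremum of the lower Darboux
-- sums.  For monotone g this supremum is both the Riemann and the Lebesgue
-- integral, and it is only used for r ↦ μ(𝔍(τ ∣ A, r)), which is monotone: the
-- clauses for γ, ∪, γ ; τ and * give families that decrease in r (for γ and γ ; τ
-- by upward closedness), and duals take complements of monotone families.
infix 4 _<∫_

_<∫_ : ∀ {ℓ} → ℝ ℓ → (𝕀 ℓ → 𝕀 ℓ) → Set (lsuc ℓ)
q <∫ g = ∃ λ π → StepBelow g 0ℚ π × q <ᴿ fromℚ (area 0ℚ π)

------------------------------------------------------------------------
-- Stochastic effectivity functions

record 𝓥 {c ℓ} (S : MeasurableSpace c ℓ) : Set (lsuc (c ⊔ lsuc ℓ)) where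
  field
    members    : Pred (Pred (Subprobability S) (c ⊔ lsuc ℓ)) ℓ
    measurable : ∀ {W} → W ∈ members → W ∈ 𝓑 (Sub S)
    upward     : ∀ {W W′} → W ∈ members → W ⊆ W′ → W′ ∈ 𝓑 (Sub S) → W′ ∈ members

infix 4 _∈ⱽ_

_∈ⱽ_ : ∀ {c ℓ} {S : MeasurableSpace c ℓ} →
       Pred (Subprobability S) (c ⊔ lsuc ℓ) → 𝓥 S → Set ℓ
W ∈ⱽ V = W ∈ 𝓥.members V

TMeasurable : ∀ {c ℓ} (S : MeasurableSpace c ℓ) → (Carrier S → 𝓥 S) →
              Set (lsuc (c ⊔ lsuc ℓ))
TMeasurable {ℓ = ℓ} S P = ∀ {H} → H ∈ 𝓑 (Sub S ⊗ [0,1] ℓ) →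
  (λ (s , q) → (λ μ → (μ , q) ∈ H) ∈ⱽ P s) ∈ 𝓑 (S ⊗ [0,1] ℓ)

record StochasticEffectivity {c ℓ} (S : MeasurableSpace c ℓ) :
       Set (lsuc (c ⊔ lsuc ℓ)) where
  field
    apply       : Carrier S → 𝓥 S
    tMeasurable : TMeasurable S apply

open StochasticEffectivity public using (apply)

IsMorphism : ∀ {c ℓ} {S T : MeasurableSpace c ℓ} →
             StochasticEffectivity S → StochasticEffectivity T →
             (f : Carrier S → Carrier T) → Measurable S T f → Set (lsuc (c ⊔ lsuc ℓ))
IsMorphism {S = S} {T = T} P Q f mf = ∀ s W → W ∈ 𝓑 (Sub T) →
  W ∈ⱽ apply Q (f s) ⇔ (Sub-map {S = S} {T = T} f mf ⊢ W) ∈ⱽ apply P s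

------------------------------------------------------------------------
-- Games

infixl 10 _ᵈ _* _ˣ
infixr 9 _⨾_
infixl 8 _∩ᵍ_
infixl 7 _∪ᵍ_

data Game {g} (Γ : Set g) : Set g where
  prim           : Γ → Game Γ
  _ᵈ _* _ˣ       : Game Γ → Game Γ
  _∪ᵍ_ _∩ᵍ_ _⨾_ : Game Γ → Game Γ → Game Γ

record GameFrame {g} (Γ : Set g) (ε : Γ) (c ℓ : Level) :
       Set (g ⊔ lsuc (lsuc (c ⊔ lsuc ℓ))) where
  field
    space : MeasurableSpace c ℓ
    P     : Γ → StochasticEffectivity space
    P-ε   : ∀ s W → W ∈ⱽ apply (P ε) s ⇔ (W ∈ 𝓑 (Sub space) × δ s ∈ W)

  State : Set c
  State = Carrier space

Q² : ∀ {ℓ} → ℝ ℓ → Pred (ℚ × ℚ) ℓ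
Q² q (a , b) = 0ℚ ℚ.≤ a × 0ℚ ℚ.≤ b × fromℚ (a ℚ.+ b) ≤ᴿ q

partialSum : (ℕ → ℚ) → ℕ → ℚ
partialSum a ℕ.zero    = 0ℚ
partialSum a (ℕ.suc n) = partialSum a n ℚ.+ a n

-- A series of nonnegative terms has sum ≤ q iff all its partial sums are ≤ q.
Q∞ : ∀ {ℓ} → ℝ ℓ → Pred (ℕ → ℚ) ℓ
Q∞ q a = (∀ n → 0ℚ ℚ.≤ a n) × (∀ n → fromℚ (partialSum a n) ≤ᴿ q)

module Interpretation {g : Level} {Γ : Set g} {ε : Γ} {c ℓ : Level} (𝒢 : GameFrame Γ ε c ℓ) where
  open GameFrame 𝒢

  -- The type of 𝔍(τ ∣ _ , _).  Sets A need not be measurable and q may be any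
  -- real; the values at measurable A and q ≥ 0 involve no others, provided the
  -- sets 𝔍(τ ∣ A, r) are measurable, as they are over a space that is closed
  -- under the Souslin operation.
  Effect : Set (c ⊔ lsuc ℓ)
  Effect = Pred State ℓ → ℝ ℓ → Pred State ℓ

  dual : Effect → Effect
  dual K A q = ∁ (K (∁ A) q)

  choice : Effect → Effect → Effect
  choice K L A q s = ∀ a b → (a , b) ∈ Q² q → s ∈ (K A (fromℚ a) ∪ L A (fromℚ b))

  countableChoice : (ℕ → Effect) → Effect
  countableChoice K A q s = ∀ a → a ∈ Q∞ q → ∃ λ n → s ∈ K n A (fromℚ (a n))

  -- G_τ(A , q), for K = 𝔍(τ ∣ _ , _); measurability of the sets 𝔍(τ ∣ A, r) is
  -- part of membership.
  G : Effect → Pred State ℓ → ℝ ℓ → Pred (Subprobability space) (c ⊔ lsuc ℓ)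
  G K A q μ = Σ (∀ (r : 𝕀 ℓ) → K A (value r) ∈ 𝓑 space) λ m →
    q <∫ λ r → measure μ (K A (value r)) (m r)

  after : Γ → Effect → Effect
  after γ K A q s = G K A q ∈ⱽ apply (P γ) s

  -- play τ K is 𝔍(τ ; τ₀ ∣ _ , _) for K = 𝔍(τ₀ ∣ _ , _).  Taking the interpretation
  -- of τ₀ as an argument reads off 𝔍 along the normal form of a game: iterated
  -- composition is associated to the right, the first factor is expanded, and
  -- duals are moved by τ₁ᵈ ; τ₀ = (τ₁ ; τ₀ᵈ)ᵈ, where τ₀ = (τ₀ᵈ)ᵈ.
  play : Game Γ → Effect → Effect
  play (prim γ)   K     = after γ K
  play (τ ᵈ)      K     = dual (play τ (dual K))
  play (τ₁ ∪ᵍ τ₂) K     = choice (play τ₁ K) (play τ₂ K)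
  play (τ₁ ∩ᵍ τ₂) K     =
    dual (choice (dual (play τ₁ K)) (dual (play τ₂ K)))
  play (τ₁ ⨾ τ₂)  K     = play τ₁ (play τ₂ K)
  play (τ *)      K     = countableChoice (fold K (play τ))
  -- τˣ = ((τᵈ)*)ᵈ
  play (τ ˣ)      K     =
    dual (countableChoice (fold (dual K) λ L → dual (play τ (dual L))))

  bare : Γ → Effect
  bare γ A q s = 𝜷 space A q ∈ⱽ apply (P γ) s

  𝔍 : Game Γ → Effect
  𝔍 (prim γ)   = bare γ
  𝔍 (τ ᵈ)      = dual (𝔍 τ)
  𝔍 (τ₁ ∪ᵍ τ₂) = choice (𝔍 τ₁) (𝔍 τ₂)
  𝔍 (τ₁ ∩ᵍ τ₂) = dual (choice (dual (𝔍 τ₁)) (dual (𝔍 τ₂)))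
  𝔍 (τ₁ ⨾ τ₂)  = play τ₁ (𝔍 τ₂)
  𝔍 (τ *)      = play (τ *) (bare ε)
  𝔍 (τ ˣ)      = dual (play ((τ ᵈ) *) (bare ε))

------------------------------------------------------------------------
-- The interpretation respects the identifications of games

infix 4 _≅_

-- The infinite expansion of τ* ; τ₀ and the reading of a bare τ* as τ* ; ε are
-- not listed: they are built into play and 𝔍.  The latter concerns only a τ* that
-- is not followed by a further game.
data _≅_ {g} {Γ : Set g} : Game Γ → Game Γ → Set g where
  ≅-refl   : ∀ {τ} → τ ≅ τ
  ≅-sym    : ∀ {τ₁ τ₂} → τ₁ ≅ τ₂ → τ₂ ≅ τ₁
  ≅-trans  : ∀ {τ₁ τ₂ τ₃} → τ₁ ≅ τ₂ → τ₂ ≅ τ₃ → τ₁ ≅ τ₃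
  ᵈ-cong   : ∀ {τ₁ τ₂} → τ₁ ≅ τ₂ → τ₁ ᵈ ≅ τ₂ ᵈ
  *-cong   : ∀ {τ₁ τ₂} → τ₁ ≅ τ₂ → τ₁ * ≅ τ₂ *
  ˣ-cong   : ∀ {τ₁ τ₂} → τ₁ ≅ τ₂ → τ₁ ˣ ≅ τ₂ ˣ
  ∪-cong   : ∀ {τ₁ τ₂ υ₁ υ₂} → τ₁ ≅ τ₂ → υ₁ ≅ υ₂ → τ₁ ∪ᵍ υ₁ ≅ τ₂ ∪ᵍ υ₂
  ∩-cong   : ∀ {τ₁ τ₂ υ₁ υ₂} → τ₁ ≅ τ₂ → υ₁ ≅ υ₂ → τ₁ ∩ᵍ υ₁ ≅ τ₂ ∩ᵍ υ₂
  ⨾-cong   : ∀ {τ₁ τ₂ υ₁ υ₂} → τ₁ ≅ τ₂ → υ₁ ≅ υ₂ → τ₁ ⨾ υ₁ ≅ τ₂ ⨾ υ₂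
  ᵈᵈ       : ∀ {τ} → (τ ᵈ) ᵈ ≅ τ
  ∩-as-∪   : ∀ {τ₁ τ₂} → τ₁ ∩ᵍ τ₂ ≅ (τ₁ ᵈ ∪ᵍ τ₂ ᵈ) ᵈ
  ˣᵈ       : ∀ {τ} → (τ ˣ) ᵈ ≅ (τ ᵈ) *
  ∪-⨾      : ∀ {τ₁ τ₂ τ} → (τ₁ ∪ᵍ τ₂) ⨾ τ ≅ τ₁ ⨾ τ ∪ᵍ τ₂ ⨾ τ
  ⨾ᵈ       : ∀ {τ₁ τ₂} → (τ₁ ⨾ τ₂) ᵈ ≅ τ₁ ᵈ ⨾ τ₂ ᵈ
  ∪-comm   : ∀ {τ₁ τ₂} → τ₁ ∪ᵍ τ₂ ≅ τ₂ ∪ᵍ τ₁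
  ∪-assoc  : ∀ {τ₁ τ₂ τ₃} → (τ₁ ∪ᵍ τ₂) ∪ᵍ τ₃ ≅ τ₁ ∪ᵍ (τ₂ ∪ᵍ τ₃)
  ∩-comm   : ∀ {τ₁ τ₂} → τ₁ ∩ᵍ τ₂ ≅ τ₂ ∩ᵍ τ₁
  ∩-assoc  : ∀ {τ₁ τ₂ τ₃} → (τ₁ ∩ᵍ τ₂) ∩ᵍ τ₃ ≅ τ₁ ∩ᵍ (τ₂ ∩ᵍ τ₃)
  ⨾-assoc  : ∀ {τ₁ τ₂ τ₃} → (τ₁ ⨾ τ₂) ⨾ τ₃ ≅ τ₁ ⨾ (τ₂ ⨾ τ₃)

module Invariance {g : Level} {Γ : Set g} {ε : Γ} {c ℓ : Level} (em : ExcludedMiddle ℓ)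
                  (𝒢 : GameFrame Γ ε c ℓ) where
  open GameFrame 𝒢
  open Interpretation 𝒢

  infix 4 _∼_

  record _∼_ (K L : Effect) : Set (c ⊔ lsuc ℓ) where
    constructor mk
    field
      at : ∀ {A B} q → A ≐ B → K A q ≐ L B q

  open _∼_

  private
    swap-≐ : ∀ {k x} {X : Set x} {A B : Pred X k} → A ≐ B → B ≐ A
    swap-≐ (A⊆B , B⊆A) = B⊆A , A⊆B

    ∼-sym : ∀ {K L} → K ∼ L → L ∼ K
    ∼-sym e .at q A≐B = swap-≐ (e .at q (swap-≐ A≐B))

    ∼-trans : ∀ {K L M} → K ∼ L → L ∼ M → K ∼ M
    ∼-trans e f .at q A≐B with e .at q A≐B | f .at q (id , id)
    ... | K⊆L , L⊆K | L⊆M , M⊆L = L⊆M ∘ K⊆L , L⊆K ∘ M⊆L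

    ∁-cong : {A B : Pred State ℓ} → A ≐ B → ∁ A ≐ ∁ B
    ∁-cong (A⊆B , B⊆A) = (λ s∉A s∈B → s∉A (B⊆A s∈B)) , (λ s∉B s∈A → s∉B (A⊆B s∈A))

    ∁∁ : {A B : Pred State ℓ} → A ≐ B → ∁ (∁ A) ≐ B
    ∁∁ (A⊆B , B⊆A) = (λ ¬¬a → A⊆B (decidable-stable em ¬¬a)) , λ s∈B s∉A → s∉A (B⊆A s∈B)

    dual-cong : ∀ {K L} → K ∼ L → dual K ∼ dual L
    dual-cong e .at q A≐B = ∁-cong (e .at q (∁-cong A≐B))

    dual-dual : ∀ {K L} → K ∼ L → dual (dual K) ∼ L
    dual-dual e .at q A≐B = ∁∁ (e .at q (∁∁ A≐B))

    choice-cong : ∀ {K K′ L L′} → K ∼ K′ → L ∼ L′ → choice K L ∼ choice K′ L′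
    choice-cong e f .at q A≐B =
      (λ s∈ a b ab∈ → Sum.map (proj₁ (e .at _ A≐B)) (proj₁ (f .at _ A≐B)) (s∈ a b ab∈)) ,
      (λ s∈ a b ab∈ → Sum.map (proj₂ (e .at _ A≐B)) (proj₂ (f .at _ A≐B)) (s∈ a b ab∈))

    choice-comm : ∀ {K K′ L L′} → K ∼ K′ → L ∼ L′ → choice K L ∼ choice L′ K′
    choice-comm e f .at q A≐B =
      (λ s∈ a b ab∈ → Sum.swap (Sum.map (proj₁ (e .at _ A≐B)) (proj₁ (f .at _ A≐B))
        (s∈ b a (swap-Q ab∈)))) ,
      (λ s∈ a b ab∈ → Sum.swap (Sum.map (proj₂ (f .at _ A≐B)) (proj₂ (e .at _ A≐B))
        (s∈ b a (swap-Q ab∈))))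
      where
      swap-Q : ∀ {a b} → (a , b) ∈ Q² q → (b , a) ∈ Q² q
      swap-Q {a} {b} (0≤a , 0≤b , a+b≤q) =
        0≤b , 0≤a , subst (λ x → fromℚ x ≤ᴿ q) (ℚ.+-comm a b) a+b≤q

    fromℚ-mono : ∀ {a b} → a ℚ.≤ b → fromℚ {ℓ} a ≤ᴿ fromℚ b
    fromℚ-mono a≤b _ (lift p<a) = lift (ℚ.<-≤-trans p<a a≤b)

    fromℚ-reflects : ∀ {a b} → fromℚ {ℓ} a ≤ᴿ fromℚ b → a ℚ.≤ b
    fromℚ-reflects {a} {b} a≤b =
      ℚ.≮⇒≥ λ b<a → ℚ.<-irrefl refl (lower (a≤b b (lift b<a)))

    module _ {q : ℝ ℓ} where

      ≤-weaken : ∀ {a b} → b ℚ.≤ a → fromℚ a ≤ᴿ q → fromℚ b ≤ᴿ q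
      ≤-weaken b≤a a≤q p p<b = a≤q p (fromℚ-mono b≤a p p<b)

      assocʳ : ∀ a b c → fromℚ (a ℚ.+ b ℚ.+ c) ≤ᴿ q → fromℚ (a ℚ.+ (b ℚ.+ c)) ≤ᴿ q
      assocʳ a b c = subst (λ x → fromℚ x ≤ᴿ q) (ℚ.+-assoc a b c)

      assocˡ : ∀ a b c → fromℚ (a ℚ.+ (b ℚ.+ c)) ≤ᴿ q → fromℚ (a ℚ.+ b ℚ.+ c) ≤ᴿ q
      assocˡ a b c = subst (λ x → fromℚ x ≤ᴿ q) (sym (ℚ.+-assoc a b c))

    choice₃ : Effect → Effect → Effect → Effect
    choice₃ K L M A q s = ∀ a b d → 0ℚ ℚ.≤ a → 0ℚ ℚ.≤ b → 0ℚ ℚ.≤ d →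
      fromℚ (a ℚ.+ (b ℚ.+ d)) ≤ᴿ q →
      s ∈ K A (fromℚ a) ⊎ s ∈ L A (fromℚ b) ⊎ s ∈ M A (fromℚ d)

    choice₃-cong : ∀ {K K′ L L′ M M′} → K ∼ K′ → L ∼ L′ → M ∼ M′ →
                   choice₃ K L M ∼ choice₃ K′ L′ M′
    choice₃-cong e f h .at q A≐B =
      (λ s∈ a b d 0≤a 0≤b 0≤d ≤q → Sum.map (proj₁ (e .at _ A≐B))
        (Sum.map (proj₁ (f .at _ A≐B)) (proj₁ (h .at _ A≐B))) (s∈ a b d 0≤a 0≤b 0≤d ≤q)) ,
      (λ s∈ a b d 0≤a 0≤b 0≤d ≤q → Sum.map (proj₂ (e .at _ A≐B))
        (Sum.map (proj₂ (f .at _ A≐B)) (proj₂ (h .at _ A≐B))) (s∈ a b d 0≤a 0≤b 0≤d ≤q))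

    choice-left : ∀ K L M A q → choice (choice K L) M A q ≐ choice₃ K L M A q
    choice-left K L M A q = to , from
      where
      to : choice (choice K L) M A q ⊆ choice₃ K L M A q
      to s∈ a b d 0≤a 0≤b 0≤d ≤q
        with s∈ (a ℚ.+ b) d (ℚ.+-mono-≤ 0≤a 0≤b , 0≤d , assocˡ {q} a b d ≤q)
      ... | inj₁ s∈KL = Sum.map id inj₁ (s∈KL a b (0≤a , 0≤b , λ _ → id))
      ... | inj₂ s∈M  = inj₂ (inj₂ s∈M)
      from : choice₃ K L M A q ⊆ choice (choice K L) M A q
      from {s} s∈ ab d (0≤ab , 0≤d , ≤q) with em {s ∈ M A (fromℚ d)}
      ... | yes s∈M = inj₂ s∈M
      ... | no  s∉M = inj₁ λ a b (0≤a , 0≤b , a+b≤ab) →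
        Sum.map id Sum.[ id , (λ s∈M → ⊥-elim (s∉M s∈M)) ]
          (s∈ a b d 0≤a 0≤b 0≤d (assocʳ {q} a b d
            (≤-weaken {q} (ℚ.+-monoˡ-≤ d (fromℚ-reflects {b = ab} a+b≤ab)) ≤q)))

    choice-right : ∀ K L M A q → choice K (choice L M) A q ≐ choice₃ K L M A q
    choice-right K L M A q = to , from
      where
      to : choice K (choice L M) A q ⊆ choice₃ K L M A q
      to s∈ a b d 0≤a 0≤b 0≤d ≤q =
        Sum.map id (λ s∈LM → s∈LM b d (0≤b , 0≤d , λ _ → id))
          (s∈ a (b ℚ.+ d) (0≤a , ℚ.+-mono-≤ 0≤b 0≤d , ≤q))
      from : choice₃ K L M A q ⊆ choice K (choice L M) A q
      from {s} s∈ a bd (0≤a , 0≤bd , ≤q) with em {s ∈ K A (fromℚ a)}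
      ... | yes s∈K = inj₁ s∈K
      ... | no  s∉K = inj₂ λ b d (0≤b , 0≤d , b+d≤bd) →
        Sum.[ (λ s∈K → ⊥-elim (s∉K s∈K)) , id ]
          (s∈ a b d 0≤a 0≤b 0≤d
            (≤-weaken {q} (ℚ.+-monoʳ-≤ a (fromℚ-reflects {b = bd} b+d≤bd)) ≤q))

    choice-assoc : ∀ {K K′ L L′ M M′} → K ∼ K′ → L ∼ L′ → M ∼ M′ →
                   choice (choice K L) M ∼ choice K′ (choice L′ M′)
    choice-assoc {K} {K′} {L} {L′} {M} {M′} e f h .at {A} {B} q A≐B
      with choice-left K L M A q | choice-right K′ L′ M′ B q
         | choice₃-cong e f h .at q A≐B
    ... | l , l′ | r , r′ | m , m′ = (λ x → r′ (m (l x))) , (λ x → l′ (m′ (r x)))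

    ∩-assoc-∼ : ∀ {K K′ L L′ M M′} → K ∼ K′ → L ∼ L′ → M ∼ M′ →
      dual (choice (dual (dual (choice (dual K) (dual L)))) (dual M)) ∼
      dual (choice (dual K′) (dual (dual (choice (dual L′) (dual M′)))))
    ∩-assoc-∼ e f h =
      let K = dual-cong e; L = dual-cong f; M = dual-cong h
          L′ = ∼-trans (∼-sym L) L; M′ = ∼-trans (∼-sym M) M
      in dual-cong (∼-trans (choice-cong (dual-dual (choice-cong K L)) M)
           (∼-trans (choice-assoc (∼-sym K) L′ M′)
             (choice-cong K (∼-sym (dual-dual (choice-cong L′ M′))))))

    countableChoice-cong : ∀ {K L} → (∀ n → K n ∼ L n) →
                           countableChoice K ∼ countableChoice L
    countableChoice-cong e .at q A≐B =
      (λ s∈ a a∈ → let n , s∈K = s∈ a a∈ in n , proj₁ (e n .at _ A≐B) s∈K) ,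
      (λ s∈ a a∈ → let n , s∈L = s∈ a a∈ in n , proj₂ (e n .at _ A≐B) s∈L)

    StepBelow-mono : ∀ {f h : 𝕀 ℓ → 𝕀 ℓ} → (∀ r → value (f r) ≤ᴿ value (h r)) →
                     ∀ {a} π → StepBelow f a π → StepBelow h a π
    StepBelow-mono f≤h []            a≡1               = a≡1
    StepBelow-mono f≤h ((b , h) ∷ π) (a≤b , h≤f , π≤f) =
      a≤b , (λ r a≤r r≤b p p<h → f≤h r p (h≤f r a≤r r≤b p p<h)) , StepBelow-mono f≤h π π≤f

    G-cong : ∀ {K L A B} q → K ∼ L → A ≐ B → G K A q ⊆ G L B q
    G-cong q e A≐B {μ} (m , π , π≤ , q<π) =
      m′ , π ,
      StepBelow-mono (λ r → proj₁ (Subprobability.ext μ (m r) (m′ r) (e .at _ A≐B))) π π≤ , q<π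
      where
      m′ : ∀ r → _ ∈ 𝓑 space
      m′ r = MeasurableSpace.resp space (e .at (value r) A≐B) (m r)

    ∈ⱽ-resp : ∀ {W W′} (V : 𝓥 space) → W ≐ W′ → W ∈ⱽ V → W′ ∈ⱽ V
    ∈ⱽ-resp V W≐W′ W∈ =
      𝓥.upward V W∈ (proj₁ W≐W′) (resp W≐W′ (𝓥.measurable V W∈))

    after-cong : ∀ γ {K L} → K ∼ L → after γ K ∼ after γ L
    after-cong γ {K} {L} e .at {A} {B} q A≐B = ∈ⱽ-resp (apply (P γ) _) W≐W′ ,
                                                   ∈ⱽ-resp (apply (P γ) _) (swap-≐ W≐W′)
      where
      W≐W′ : G K A q ≐ G L B q
      W≐W′ = (λ {μ} → G-cong q e A≐B {μ}) ,
             (λ {μ} → G-cong q (∼-sym e) (swap-≐ A≐B) {μ})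

    𝜷-cong : ∀ {A B} q → A ≐ B → 𝜷 space A q ⊆ 𝜷 space B q
    𝜷-cong q A≐B {μ} (mA , p , p∈ , p∉q) =
      mB , p , proj₁ (Subprobability.ext μ mA mB A≐B) p p∈ , p∉q
      where mB = MeasurableSpace.resp space A≐B mA

    bare-cong : ∀ γ → bare γ ∼ bare γ
    bare-cong γ .at {A} {B} q A≐B = ∈ⱽ-resp (apply (P γ) _) W≐W′ ,
                                     ∈ⱽ-resp (apply (P γ) _) (swap-≐ W≐W′)
      where
      W≐W′ : 𝜷 space A q ≐ 𝜷 space B q
      W≐W′ = (λ {μ} → 𝜷-cong q A≐B {μ}) , (λ {μ} → 𝜷-cong q (swap-≐ A≐B) {μ})

    fold-cong : ∀ {K L} {F H : Effect → Effect} → K ∼ L →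
                (∀ {K L} → K ∼ L → F K ∼ H L) → ∀ n → fold K F n ∼ fold L H n
    fold-cong e f ℕ.zero    = e
    fold-cong e f (ℕ.suc n) = f (fold-cong e f n)

    ∼-reflˡ : ∀ {K L} → K ∼ L → K ∼ K
    ∼-reflˡ e = ∼-trans e (∼-sym e)

    play-refl : ∀ τ {K L} → K ∼ L → play τ K ∼ play τ L
    play-refl (prim γ)   e = after-cong γ e
    play-refl (τ ᵈ)      e = dual-cong (play-refl τ (dual-cong e))
    play-refl (τ₁ ∪ᵍ τ₂) e = choice-cong (play-refl τ₁ e) (play-refl τ₂ e)
    play-refl (τ₁ ∩ᵍ τ₂) e =
      dual-cong (choice-cong (dual-cong (play-refl τ₁ e)) (dual-cong (play-refl τ₂ e)))
    play-refl (τ₁ ⨾ τ₂)  e = play-refl τ₁ (play-refl τ₂ e)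
    play-refl (τ *)      e = countableChoice-cong (fold-cong e (play-refl τ))
    play-refl (τ ˣ)      e = dual-cong (countableChoice-cong
      (fold-cong (dual-cong e) λ e → dual-cong (play-refl τ (dual-cong e))))

  play-resp : ∀ {τ υ} → τ ≅ υ → ∀ {K L} → K ∼ L → play τ K ∼ play υ L
  play-resp {τ} ≅-refl e = play-refl τ e
  play-resp (≅-sym i) e = ∼-sym (play-resp i (∼-sym e))
  play-resp (≅-trans i j) e = ∼-trans (play-resp i e) (play-resp j (∼-reflˡ (∼-sym e)))
  play-resp (ᵈ-cong i) e = dual-cong (play-resp i (dual-cong e))
  play-resp (*-cong i) e = countableChoice-cong (fold-cong e (play-resp i))
  play-resp (ˣ-cong i) e = dual-cong (countableChoice-cong
    (fold-cong (dual-cong e) λ e → dual-cong (play-resp i (dual-cong e))))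
  play-resp (∪-cong i j) e = choice-cong (play-resp i e) (play-resp j e)
  play-resp (∩-cong i j) e =
    dual-cong (choice-cong (dual-cong (play-resp i e)) (dual-cong (play-resp j e)))
  play-resp (⨾-cong i j) e = play-resp i (play-resp j e)
  play-resp (ᵈᵈ {τ}) e = dual-dual (play-refl τ (dual-dual e))
  play-resp (∩-as-∪ {τ₁} {τ₂}) e =
    dual-cong (choice-cong (dual-cong (play-refl τ₁ (∼-sym (dual-dual (∼-sym e)))))
                           (dual-cong (play-refl τ₂ (∼-sym (dual-dual (∼-sym e))))))
  play-resp (ˣᵈ {τ}) e = dual-dual (countableChoice-cong
    (fold-cong (dual-dual e) λ e → dual-cong (play-refl τ (dual-cong e))))
  play-resp (∪-⨾ {τ₁} {τ₂} {τ}) e =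
    choice-cong (play-refl τ₁ (play-refl τ e)) (play-refl τ₂ (play-refl τ e))
  play-resp (⨾ᵈ {τ₁} {τ₂}) e =
    dual-cong (play-refl τ₁ (∼-sym (dual-dual (play-refl τ₂ (dual-cong (∼-sym e))))))
  play-resp (∪-comm {τ₁} {τ₂}) e = choice-comm (play-refl τ₁ e) (play-refl τ₂ e)
  play-resp (∪-assoc {τ₁} {τ₂} {τ₃}) e =
    choice-assoc (play-refl τ₁ e) (play-refl τ₂ e) (play-refl τ₃ e)
  play-resp (∩-comm {τ₁} {τ₂}) e =
    dual-cong (choice-comm (dual-cong (play-refl τ₁ e)) (dual-cong (play-refl τ₂ e)))
  play-resp (∩-assoc {τ₁} {τ₂} {τ₃}) e =
    ∩-assoc-∼ (play-refl τ₁ e) (play-refl τ₂ e) (play-refl τ₃ e)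
  play-resp (⨾-assoc {τ₁} {τ₂} {τ₃}) e = play-refl τ₁ (play-refl τ₂ (play-refl τ₃ e))

  private
    𝔍-refl : ∀ τ → 𝔍 τ ∼ 𝔍 τ
    𝔍-refl (prim γ)   = bare-cong γ
    𝔍-refl (τ ᵈ)      = dual-cong (𝔍-refl τ)
    𝔍-refl (τ₁ ∪ᵍ τ₂) = choice-cong (𝔍-refl τ₁) (𝔍-refl τ₂)
    𝔍-refl (τ₁ ∩ᵍ τ₂) = dual-cong (choice-cong (dual-cong (𝔍-refl τ₁)) (dual-cong (𝔍-refl τ₂)))
    𝔍-refl (τ₁ ⨾ τ₂)  = play-refl τ₁ (𝔍-refl τ₂)
    𝔍-refl (τ *)      = play-refl (τ *) (bare-cong ε)
    𝔍-refl (τ ˣ)      = dual-cong (play-refl ((τ ᵈ) *) (bare-cong ε))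

  𝔍-resp : ∀ {τ υ} → τ ≅ υ → 𝔍 τ ∼ 𝔍 υ
  𝔍-resp {τ} ≅-refl = 𝔍-refl τ
  𝔍-resp (≅-sym i) = ∼-sym (𝔍-resp i)
  𝔍-resp (≅-trans i j) = ∼-trans (𝔍-resp i) (𝔍-resp j)
  𝔍-resp (ᵈ-cong i) = dual-cong (𝔍-resp i)
  𝔍-resp (*-cong i) = play-resp (*-cong i) (bare-cong ε)
  𝔍-resp (ˣ-cong i) = dual-cong (play-resp (*-cong (ᵈ-cong i)) (bare-cong ε))
  𝔍-resp (∪-cong i j) = choice-cong (𝔍-resp i) (𝔍-resp j)
  𝔍-resp (∩-cong i j) = dual-cong (choice-cong (dual-cong (𝔍-resp i)) (dual-cong (𝔍-resp j)))
  𝔍-resp (⨾-cong i j) = play-resp i (𝔍-resp j)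
  𝔍-resp (ᵈᵈ {τ}) = dual-dual (𝔍-refl τ)
  𝔍-resp (∩-as-∪ {τ₁} {τ₂}) = 𝔍-refl (τ₁ ∩ᵍ τ₂)
  𝔍-resp (ˣᵈ {τ}) = dual-dual (𝔍-refl ((τ ᵈ) *))
  𝔍-resp (∪-⨾ {τ₁} {τ₂} {τ}) = 𝔍-refl (τ₁ ⨾ τ ∪ᵍ τ₂ ⨾ τ)
  𝔍-resp (⨾ᵈ {τ₁} {τ₂}) =
    dual-cong (play-refl τ₁ (∼-sym (dual-dual (𝔍-refl τ₂))))
  𝔍-resp (∪-comm {τ₁} {τ₂}) = choice-comm (𝔍-refl τ₁) (𝔍-refl τ₂)
  𝔍-resp (∪-assoc {τ₁} {τ₂} {τ₃}) =
    choice-assoc (𝔍-refl τ₁) (𝔍-refl τ₂) (𝔍-refl τ₃)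
  𝔍-resp (∩-comm {τ₁} {τ₂}) =
    dual-cong (choice-comm (dual-cong (𝔍-refl τ₁)) (dual-cong (𝔍-refl τ₂)))
  𝔍-resp (∩-assoc {τ₁} {τ₂} {τ₃}) =
    ∩-assoc-∼ (𝔍-refl τ₁) (𝔍-refl τ₂) (𝔍-refl τ₃)
  𝔍-resp (⨾-assoc {τ₁} {τ₂} {τ₃}) = 𝔍-refl (τ₁ ⨾ (τ₂ ⨾ τ₃))

------------------------------------------------------------------------
-- Game logic

data Formula {g p} (Γ : Set g) (Ψ : Set p) (ℓ : Level) : Set (g ⊔ p ⊔ lsuc ℓ) where
  ⊤ᶠ      : Formula Γ Ψ ℓ
  atom    : Ψ → Formula Γ Ψ ℓ
  _∧ᶠ_    : Formula Γ Ψ ℓ → Formula Γ Ψ ℓ → Formula Γ Ψ ℓ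
  ⟨_⟩[_]_ : Game Γ → 𝕀 ℓ → Formula Γ Ψ ℓ → Formula Γ Ψ ℓ

record GameModel {g p} (Γ : Set g) (ε : Γ) (Ψ : Set p) (c ℓ : Level) :
       Set (g ⊔ p ⊔ lsuc (lsuc (c ⊔ lsuc ℓ))) where
  field
    frame        : GameFrame Γ ε c ℓ
  open GameFrame frame public
  field
    V            : Ψ → Pred State ℓ
    V-measurable : ∀ p → V p ∈ 𝓑 space

open GameModel public using (State; space)

module _ {g p : Level} {Γ : Set g} {ε : Γ} {Ψ : Set p} {c ℓ : Level} where

  ⟦_⟧ : Formula Γ Ψ ℓ → (𝒢 : GameModel Γ ε Ψ c ℓ) → Pred (State 𝒢) ℓ
  ⟦ ⊤ᶠ ⟧           𝒢 = U
  ⟦ atom p ⟧       𝒢 = GameModel.V 𝒢 p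
  ⟦ φ ∧ᶠ ψ ⟧       𝒢 = ⟦ φ ⟧ 𝒢 ∩ ⟦ ψ ⟧ 𝒢
  ⟦ ⟨ τ ⟩[ q ] φ ⟧ 𝒢 = Interpretation.𝔍 (GameModel.frame 𝒢) τ (⟦ φ ⟧ 𝒢) (value q)

  infix 4 _,_⊨_

  _,_⊨_ : (𝒢 : GameModel Γ ε Ψ c ℓ) → State 𝒢 → Formula Γ Ψ ℓ → Set ℓ
  𝒢 , s ⊨ φ = s ∈ ⟦ φ ⟧ 𝒢

  record ModelMorphism (𝒢 ℋ : GameModel Γ ε Ψ c ℓ) :
         Set (g ⊔ p ⊔ lsuc (c ⊔ lsuc ℓ)) where
    private
      module 𝒢 = GameModel 𝒢
      module ℋ = GameModel ℋ
    field
      map        : State 𝒢 → State ℋ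
      measurable : Measurable (space 𝒢) (space ℋ) map
      morphism   : ∀ γ → IsMorphism (𝒢.P γ) (ℋ.P γ) map measurable
      atoms      : ∀ p → (map ⊢ ℋ.V p) ≐ 𝒢.V p

{-# OPTIONS --safe #-}
-- By induction on formulas and games, ⟦φ⟧ over 𝒢 is the preimage under f of ⟦φ⟧
-- over ℋ.  The morphism property of f says this for P_γ, but only at measurable
-- subsets of Sub(T), so it has to be shown alongside that the sets G_τ(A , q) are
-- measurable.  Each r ↦ 𝔍(τ ∣ A , r) is monotone, in a direction that depends on τ
-- only.  Hence whether a step function lies below r ↦ μ(𝔍(τ ∣ A , r)) is decided at
-- the endpoints of its finitely many pieces, and G_τ(A , q) is a countable union,
-- over rational step functions, of finite intersections of sets {μ ∣ h ≤ μ(B)}.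
-- The iteration τ* intersects over uncountably many sequences; its complement is
-- the result of the Souslin operation.
module Submission where

open import Defs
open import Axiom.ExcludedMiddle using (ExcludedMiddle)
open import Data.Empty using (⊥-elim)
open import Data.Integer.Base using (+_; -[1+_]; _⊖_)
open import Data.List.Base using (List; []; _∷_; applyUpTo)
open import Data.Nat.Base as ℕ using (ℕ; zero; suc)
import Data.Nat.Properties as ℕ
open import Data.Nat.GeneralisedArithmetic using (fold)
open import Data.Product.Base using (∃; ∃₂; _×_; _,_; proj₁; proj₂)
open import Data.Rational.Base as ℚ using (ℚ; 0ℚ; 1ℚ)
import Data.Rational.Properties as ℚ
open import Data.Sum.Base as Sum using (_⊎_; inj₁; inj₂)
open import Data.Unit.Polymorphic.Base using (tt)
open import Function.Base using (_∘_; id)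
open import Function.Bundles using (_⇔_; mk⇔; Equivalence)
open import Level using (Level; _⊔_; Lift; lift; lower) renaming (suc to lsuc)
open import Relation.Binary.Definitions using (tri<; tri≈; tri>)
open import Relation.Binary.PropositionalEquality
  using (_≡_; _≢_; refl; sym; trans; cong; cong₂; subst)
open import Relation.Nullary using (¬_; yes; no)
open import Relation.Nullary.Decidable using (decidable-stable)
open import Relation.Unary using (Pred; _∈_; _⊆_; _≐_; ∁; _∩_; _∪_; _⊢_; ⋃; ⋂)
open import Relation.Unary.Polymorphic using (∅; U)

-- Countable sets

Countable : Set → Set
Countable X = ∃ λ (enum : ℕ → X) → ∀ x → ∃ λ n → enum n ≡ x

countable-map : ∀ {X Y} (f : X → Y) → (∀ y → ∃ λ x → f x ≡ y) → Countable X → Countable Y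
countable-map f f-surj (e , e-surj) = f ∘ e , λ y →
  let x , fx≡y = f-surj y
      n , en≡x = e-surj x
  in n , trans (cong f en≡x) fx≡y

private
  -- Cantor's walk through the pairs: along an antidiagonal with constant sum, then on to the start
  -- of the next one.
  next : ℕ × ℕ → ℕ × ℕ
  next (zero  , j) = suc j , zero
  next (suc i , j) = i , suc j

  diagonal : ℕ → ℕ × ℕ
  diagonal zero    = 0 , 0
  diagonal (suc n) = next (diagonal n)

  -- The recursion follows the walk backwards. It terminates because either `j` drops on the same
  -- antidiagonal or the antidiagonal `k` itself drops.
  diagonal-surjective : ∀ k i j → i ℕ.+ j ≡ k → ∃ λ n → diagonal n ≡ (i , j)
  diagonal-surjective k i (suc j) i+j≡k =
    let n , eq = diagonal-surjective k (suc i) j (trans (sym (ℕ.+-suc i j)) i+j≡k)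
    in suc n , cong next eq
  diagonal-surjective k       zero    zero _     = 0 , refl
  diagonal-surjective (suc k) (suc i) zero i+0≡k =
    let n , eq = diagonal-surjective k 0 i
                   (ℕ.suc-injective (trans (cong suc (sym (ℕ.+-identityʳ i))) i+0≡k))
    in suc n , cong next eq

countable-ℕ×ℕ : Countable (ℕ × ℕ)
countable-ℕ×ℕ = diagonal , λ (i , j) → diagonal-surjective (i ℕ.+ j) i j refl

countable-× : ∀ {X Y} → Countable X → Countable Y → Countable (X × Y)
countable-× (d , d-surj) (e , e-surj) =
  countable-map (λ (i , j) → d i , e j)
    (λ (x , y) → let i , di≡x = d-surj x
                     j , ej≡y = e-surj y
                 in (i , j) , cong₂ _,_ di≡x ej≡y)
    countable-ℕ×ℕ

countable-List : ∀ {X} → Countable X → Countable (List X)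
countable-List {X} (e , e-surj) =
  countable-map (λ (n , k) → word n k)
    (λ xs → let n , k , eq = word-surjective xs in (n , k) , eq) countable-ℕ×ℕ
  where
  -- The length is kept apart from the code, so decoding is structural: each step splits the code
  -- into the index of the head and the code of the tail.
  word : ℕ → ℕ → List X
  word zero    k = []
  word (suc n) k = e (proj₁ (diagonal k)) ∷ word n (proj₂ (diagonal k))

  word-surjective : ∀ xs → ∃₂ λ n k → word n k ≡ xs
  word-surjective []       = 0 , 0 , refl
  word-surjective (x ∷ xs) =
    let i , ei≡x    = e-surj x
        n , k , eq  = word-surjective xs
        j , dj≡i,k  = proj₂ countable-ℕ×ℕ (i , k)
    in suc n , j , cong₂ _∷_ (trans (cong (e ∘ proj₁) dj≡i,k) ei≡x)
                             (trans (cong (word n ∘ proj₂) dj≡i,k) eq)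

countable-ℚ : Countable ℚ
countable-ℚ =
  countable-map (λ ((m , n) , d) → (m ⊖ n) ℚ./ suc d)
    (λ p → let (m , n) , eq = difference (ℚ.↥ p)
           in ((m , n) , ℚ.ℚ.denominator-1 p) ,
              trans (cong (ℚ._/ suc (ℚ.ℚ.denominator-1 p)) eq) (ℚ.↥p/↧p≡p p))
    (countable-× countable-ℕ×ℕ (id , λ n → n , refl))
  where
  difference : ∀ i → ∃ λ ((m , n) : ℕ × ℕ) → m ⊖ n ≡ i
  difference (+ n)    = (n , 0) , refl
  difference -[1+ n ] = (0 , suc n) , refl

-- Real numbers

fromℚ-mono : ∀ {ℓ a b} → a ℚ.≤ b → fromℚ {ℓ} a ≤ᴿ fromℚ b
fromℚ-mono a≤b _ (lift p<a) = lift (ℚ.<-≤-trans p<a a≤b)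

-- Finite sums start from 0, so this compares a value with its one-term sum. The cut of 0 has only
-- negative members; roundedness of `x` leaves room for `r - q` as one of them.
≤ᴿ-0+ : ∀ {ℓ} (x : ℝ ℓ) → x ≤ᴿ fromℚ 0ℚ +ᴿ x
≤ᴿ-0+ x p p∈x =
  let q , p<q , q∈x = ℝ.rounded x p∈x
      r , p<r , r<q = ℚ.<-dense p<q
  in r ℚ.- q , q ,
     lift (subst (r ℚ.- q ℚ.<_) (ℚ.+-inverseʳ q) (ℚ.+-monoˡ-< (ℚ.- q) r<q)) , q∈x ,
     subst (p ℚ.<_) (sym (trans (ℚ.+-assoc r (ℚ.- q) q)
       (trans (cong (r ℚ.+_) (ℚ.+-inverseˡ q)) (ℚ.+-identityʳ r)))) p<r

-- Step functions

StepBelow-mono : ∀ {ℓ} {f g : 𝕀 ℓ → 𝕀 ℓ} → (∀ r → value (f r) ≤ᴿ value (g r)) →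
                 ∀ {a} π → StepBelow f a π → StepBelow g a π
StepBelow-mono f≤g []            a≡1               = a≡1
StepBelow-mono f≤g ((b , h) ∷ π) (a≤b , h≤f , π≤f) =
  a≤b , (λ r a≤r r≤b p → f≤g r p ∘ h≤f r a≤r r≤b p) , StepBelow-mono f≤g π π≤f

StepBelow⇒≤1 : ∀ {ℓ} {g : 𝕀 ℓ → 𝕀 ℓ} {a} π → StepBelow g a π → a ℚ.≤ 1ℚ
StepBelow⇒≤1 []      (lift refl)      = ℚ.≤-refl
StepBelow⇒≤1 (_ ∷ π) (a≤b , _ , π≤g) = ℚ.≤-trans a≤b (StepBelow⇒≤1 π π≤g)

-- Series

-- `partialSum` recurses at the last term, whereas words are read from the first letter.
partialSum-suc : ∀ a n → partialSum a (suc n) ≡ a 0 ℚ.+ partialSum (a ∘ suc) n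
partialSum-suc a zero    = ℚ.+-comm 0ℚ (a 0)
partialSum-suc a (suc n) =
  trans (cong (ℚ._+ a (suc n)) (partialSum-suc a n)) (ℚ.+-assoc (a 0) _ _)

partialSum-cong : ∀ {a b} → (∀ n → a n ≡ b n) → ∀ n → partialSum a n ≡ partialSum b n
partialSum-cong a≡b zero    = refl
partialSum-cong a≡b (suc n) = cong₂ ℚ._+_ (partialSum-cong a≡b n) (a≡b n)

module _ (em : ∀ {a} → ExcludedMiddle a) where

  -- Measurable sets

  module Sets {c ℓ} (S : MeasurableSpace c ℓ) where
    private module S = MeasurableSpace S

    uninhabited : {A : Pred (Carrier S) ℓ} → (∀ s → ¬ (s ∈ A)) → A ∈ 𝓑 S
    uninhabited ¬A = S.resp ((λ ()) , λ s∈A → ⊥-elim (¬A _ s∈A)) S.empty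

    universal : {A : Pred (Carrier S) ℓ} → (∀ s → s ∈ A) → A ∈ 𝓑 S
    universal allA = S.resp ((λ _ → allA _) , λ _ ()) (S.compl S.empty)

    uncompl : ∀ {A} → ∁ A ∈ 𝓑 S → A ∈ 𝓑 S
    uncompl m = S.resp ((λ ¬¬a → decidable-stable em ¬¬a) , λ a ¬a → ¬a a) (S.compl m)

    ⋃-measurable : ∀ {I} → Countable I → {A : I → Pred (Carrier S) ℓ} →
                   (∀ i → A i ∈ 𝓑 S) → ⋃ I A ∈ 𝓑 S
    ⋃-measurable (e , e-surj) {A} mA = S.resp
      ((λ (n , s∈A) → e n , s∈A) ,
       λ (i , s∈A) → let n , en≡i = e-surj i in n , subst (λ j → _ ∈ A j) (sym en≡i) s∈A)
      (S.union (mA ∘ e))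

    ⋂-measurable : ∀ {I} → Countable I → {A : I → Pred (Carrier S) ℓ} →
                   (∀ i → A i ∈ 𝓑 S) → ⋂ I A ∈ 𝓑 S
    ⋂-measurable I-countable mA = S.resp
      ((λ ¬∃ i → decidable-stable em λ s∉A → ¬∃ (i , s∉A)) , λ ∀A (i , s∉A) → s∉A (∀A i))
      (S.compl (⋃-measurable I-countable (S.compl ∘ mA)))

    ∪-measurable : ∀ {A B} → A ∈ 𝓑 S → B ∈ 𝓑 S → (A ∪ B) ∈ 𝓑 S
    ∪-measurable {A} {B} mA mB = S.resp
      ((λ { (zero , s∈A) → inj₁ s∈A ; (suc _ , s∈B) → inj₂ s∈B }) ,
       λ { (inj₁ s∈A) → 0 , s∈A ; (inj₂ s∈B) → 1 , s∈B })
      (S.union {λ { zero → A ; (suc _) → B }} λ { zero → mA ; (suc _) → mB })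

    ∩-measurable : ∀ {A B} → A ∈ 𝓑 S → B ∈ 𝓑 S → (A ∩ B) ∈ 𝓑 S
    ∩-measurable mA mB = S.resp
      ((λ ¬∪ → decidable-stable em (¬∪ ∘ inj₁) , decidable-stable em (¬∪ ∘ inj₂)) ,
       λ (s∈A , s∈B) → Sum.[ (λ s∉A → s∉A s∈A) , (λ s∉B → s∉B s∈B) ])
      (S.compl (∪-measurable (S.compl mA) (S.compl mB)))

  -- Taking sections commutes with complements and unions, and the section of a rectangle A × B at
  -- `y` is A or empty, according to whether `y` lies in B.
  section-measurable : ∀ {c d ℓ} {S : MeasurableSpace c ℓ} {T : MeasurableSpace d ℓ}
    {R : Pred (Carrier S × Carrier T) ℓ} → R ∈ 𝓑 (S ⊗ T) →
    ∀ y → (λ x → (x , y) ∈ R) ∈ 𝓑 S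
  section-measurable {S = S} {T} m y = go m
    where
    go : ∀ {R} → R ∈ 𝓑 (S ⊗ T) → (λ x → (x , y) ∈ R) ∈ 𝓑 S
    go (basic (A , B , mA , _ , R⊆ , ⊆R)) with em {P = y ∈ B}
    ... | yes y∈B = MeasurableSpace.resp S ((λ x∈A → ⊆R (x∈A , y∈B)) , proj₁ ∘ R⊆) mA
    ... | no  y∉B = Sets.uninhabited S λ x → y∉B ∘ proj₂ ∘ R⊆
    go (resp (R⊆ , ⊆R) m) = MeasurableSpace.resp S (R⊆ , ⊆R) (go m)
    go empty              = MeasurableSpace.empty S
    go (compl m)          = MeasurableSpace.compl S (go m)
    go (union m)          = MeasurableSpace.union S (go ∘ m)

  -- Members are measurable, hence so is any set equivalent to one, and upward closedness applies.
  ∈ⱽ-resp : ∀ {c ℓ} {S : MeasurableSpace c ℓ} (V : 𝓥 S)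
            {W W′ : Pred (Subprobability S) (c ⊔ lsuc ℓ)} → W ≐ W′ → W ∈ⱽ V → W′ ∈ⱽ V
  ∈ⱽ-resp V W≐W′ W∈V = 𝓥.upward V W∈V (proj₁ W≐W′) (resp W≐W′ (𝓥.measurable V W∈V))

  -- Measures

  -- Countable additivity for A, B minus A, ∅, ∅, ...: the measure of A is a one-term partial sum,
  -- and the supremum is the measure of B.
  measure-mono : ∀ {c ℓ} {S : MeasurableSpace c ℓ} (μ : Subprobability S)
    {A B : Pred (Carrier S) ℓ} (mA : A ∈ 𝓑 S) (mB : B ∈ 𝓑 S) → A ⊆ B →
    value (measure μ A mA) ≤ᴿ value (measure μ B mB)
  measure-mono {ℓ = ℓ} {S} μ {A} {B} mA mB A⊆B p p∈μA =
    proj₁ (Subprobability.ext μ (MeasurableSpace.union S mD) mB (⋃D⊆B , B⊆⋃D)) p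
      (proj₁ (Subprobability.additive μ D mD disjoint) 1 p (≤ᴿ-0+ (value (measure μ A mA)) p p∈μA))
    where
    D : ℕ → Pred (Carrier S) ℓ
    D 0             = A
    D 1             = B ∩ ∁ A
    D (suc (suc _)) = ∅

    mD : ∀ n → D n ∈ 𝓑 S
    mD 0             = mA
    mD 1             = Sets.∩-measurable S mB (MeasurableSpace.compl S mA)
    mD (suc (suc _)) = MeasurableSpace.empty S

    disjoint : ∀ {i j} → i ≢ j → ∀ {x} → x ∈ D i → ¬ (x ∈ D j)
    disjoint {0} {0} i≢j _         _         = i≢j refl
    disjoint {0} {1} i≢j x∈A       (_ , x∉A) = x∉A x∈A
    disjoint {1} {0} i≢j (_ , x∉A) x∈A       = x∉A x∈A
    disjoint {1} {1} i≢j _         _         = i≢j refl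

    ⋃D⊆B : ⋃ ℕ D ⊆ B
    ⋃D⊆B (0 , x∈A)       = A⊆B x∈A
    ⋃D⊆B (1 , (x∈B , _)) = x∈B

    B⊆⋃D : B ⊆ ⋃ ℕ D
    B⊆⋃D {x} x∈B with em {P = x ∈ A}
    ... | yes x∈A = 0 , x∈A
    ... | no  x∉A = 1 , (x∈B , x∉A)

  >-measurable : ∀ {ℓ} (q : ℝ ℓ) → (λ x → q <ᴿ value x) ∈ 𝓑 ([0,1] ℓ)
  >-measurable q = basic λ x (p , p∈x , p∉q) →
    -- The left end `p` separates `q` from `x`. The right end `u + 1` is just some rational above
    -- `x`, as `IsOpen` asks for an interval bounded on both sides.
    let u , u∉x = ℝ.bounded (value x)
    in p , u ℚ.+ 1ℚ ,
       ((p , p∈x , ℚ.<-irrefl refl ∘ lower) , (u , lift (u<u+1 u) , u∉x)) ,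
       λ y (r , r∈y , r≮p) _ → r , r∈y , λ r∈q → p∉q (downwards (r≮p ∘ lift) r∈q)
    where
    u<u+1 : ∀ u → u ℚ.< u ℚ.+ 1ℚ
    u<u+1 u = subst (ℚ._< u ℚ.+ 1ℚ) (ℚ.+-identityʳ u) (ℚ.+-monoʳ-< u (ℚ.positive⁻¹ 1ℚ))

    downwards : ∀ {p r} → ¬ (r ℚ.< p) → r ∈ cut q → p ∈ cut q
    downwards {p} {r} r≮p r∈q with ℚ.<-cmp p r
    ... | tri< p<r _ _  = ℝ.down q p<r r∈q
    ... | tri≈ _ refl _ = r∈q
    ... | tri> _ _ r<p  = ⊥-elim (r≮p r<p)

  ≥-measurable : ∀ {ℓ} h → (λ x → fromℚ h ≤ᴿ value x) ∈ 𝓑 ([0,1] ℓ)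
  ≥-measurable {ℓ} h = resp
    ((λ x≮h p p<h → decidable-stable em λ p∉x → x≮h (p , p<h , p∉x)) ,
     λ h≤x (p , p<h , p∉x) → p∉x (h≤x p p<h))
    (compl (basic {A = λ x → value x <ᴿ fromℚ h} λ x x<h →
      let p , p∈x = ℝ.inhabited (value x)
      in p , h , ((p , p∈x , ℚ.<-irrefl refl ∘ lower) , x<h) , λ y _ y<h → y<h))

  evaluation-measurable : ∀ {c ℓ} {S : MeasurableSpace c ℓ} {A B} (mA : A ∈ 𝓑 S) →
    B ∈ 𝓑 ([0,1] ℓ) → (λ μ → Lift (c ⊔ lsuc ℓ) (measure μ A mA ∈ B)) ∈ 𝓑 (Sub S)
  evaluation-measurable mA mB = basic (evaluation mA mB (lower , lift))

  -- Effects over a single frame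

  module _ {g c ℓ : Level} {Γ : Set g} {ε : Γ} (𝒢 : GameFrame Γ ε c ℓ) where
    open GameFrame 𝒢 using (P) renaming (space to S)
    open Interpretation 𝒢

    Antitone : Effect → Set (c ⊔ lsuc ℓ)
    Antitone K = ∀ {A} → A ∈ 𝓑 S → ∀ {q r} → q ≤ᴿ r → K A r ⊆ K A q

    Isotone : Effect → Set (c ⊔ lsuc ℓ)
    Isotone K = ∀ {A} → A ∈ 𝓑 S → ∀ {q r} → q ≤ᴿ r → K A q ⊆ K A r

    -- The invariant of the induction on games. Both directions of monotonicity are allowed because
    -- `dual` reverses them.
    record Tame (K : Effect) : Set (c ⊔ lsuc ℓ) where
      field
        measurable : ∀ {A} → A ∈ 𝓑 S → ∀ q → K A q ∈ 𝓑 S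
        monotone   : Antitone K ⊎ Isotone K

    open Tame

    -- t-measurability is applied to the cylinder W × [0,1], all of whose sections are W; the
    -- resulting set is then cut at 0.
    effectivity-measurable : ∀ γ {W} → W ∈ 𝓑 (Sub S) →
                             (λ s → W ∈ⱽ apply (P γ) s) ∈ 𝓑 S
    effectivity-measurable γ {W} mW = section-measurable {S = S} {T = [0,1] ℓ}
      (StochasticEffectivity.tMeasurable (P γ) {λ (μ , _) → μ ∈ W}
        (basic (W , U , mW , Sets.universal ([0,1] ℓ) (λ _ → tt) , (λ w → w , tt) , proj₁)))
      (fromℚ 0ℚ [ (λ _ → id) , fromℚ-mono (ℚ.<⇒≤ (ℚ.positive⁻¹ 1ℚ)) ])

    𝜷-measurable : ∀ {A} → A ∈ 𝓑 S → ∀ q → 𝜷 S A q ∈ 𝓑 (Sub S)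
    𝜷-measurable mA q = resp
      ((λ (lift q<μA) → mA , q<μA) ,
       λ {μ} (mA′ , p , p∈μA , p∉q) →
         lift (p , proj₁ (Subprobability.ext μ mA′ mA (id , id)) p p∈μA , p∉q))
      (evaluation-measurable {S = S} mA (>-measurable q))

    -- Measurability of the sets G_τ(A , q)

    module _ {K : Effect} (tame : Tame K) {A} (mA : A ∈ 𝓑 S) where

      private
        mK : ∀ r → K A (value r) ∈ 𝓑 S
        mK r = measurable tame mA (value r)

        integrand : Subprobability S → 𝕀 ℓ → 𝕀 ℓ
        integrand μ r = measure μ (K A (value r)) (mK r)

        level-measurable : ∀ h r →
          (λ μ → Lift (c ⊔ lsuc ℓ) (fromℚ h ≤ᴿ value (integrand μ r))) ∈ 𝓑 (Sub S)
        level-measurable h r = evaluation-measurable {S = S} (mK r) (≥-measurable h)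

      -- By monotonicity of measures the condition is tightest at one end of the piece: the right
      -- end if `K` is antitone, the left end if it is isotone. The bounds 0 and 1 make both ends
      -- points of `𝕀`.
      piece-measurable : ∀ {a b} → 0ℚ ℚ.≤ a → a ℚ.≤ b → b ℚ.≤ 1ℚ → ∀ h →
        (λ μ → Lift c (∀ r → fromℚ a ≤ᴿ value r → value r ≤ᴿ fromℚ b →
                       fromℚ h ≤ᴿ value (integrand μ r))) ∈ 𝓑 (Sub S)
      piece-measurable {a} {b} 0≤a a≤b b≤1 h with monotone tame
      ... | inj₁ antitone = resp
        ((λ {μ} (lift h≤) → lift λ r _ r≤b p p<h →
            measure-mono μ (mK right) (mK r) (antitone mA r≤b) p (h≤ p p<h)) ,
         λ (lift h≤) → lift (h≤ right (fromℚ-mono a≤b) (λ _ → id)))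
        (level-measurable h right)
        where
        right = fromℚ b [ fromℚ-mono (ℚ.≤-trans 0≤a a≤b) , fromℚ-mono b≤1 ]
      ... | inj₂ isotone = resp
        ((λ {μ} (lift h≤) → lift λ r a≤r _ p p<h →
            measure-mono μ (mK left) (mK r) (isotone mA a≤r) p (h≤ p p<h)) ,
         λ (lift h≤) → lift (h≤ left (λ _ → id) (fromℚ-mono a≤b)))
        (level-measurable h left)
        where
        left = fromℚ a [ fromℚ-mono 0≤a , fromℚ-mono (ℚ.≤-trans a≤b b≤1) ]

      StepBelow-measurable : ∀ {a} → 0ℚ ℚ.≤ a → ∀ π →
        (λ μ → Lift c (StepBelow (integrand μ) a π)) ∈ 𝓑 (Sub S)
      StepBelow-measurable {a} 0≤a [] with em {P = a ≡ 1ℚ}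
      ... | yes a≡1 = Sets.universal (Sub S) λ _ → lift (lift a≡1)
      ... | no  a≢1 = Sets.uninhabited (Sub S) λ _ → a≢1 ∘ lower ∘ lower
      -- A list that steps backwards or passes 1 lies below no function, since its breakpoints must
      -- increase weakly and end at 1.
      StepBelow-measurable {a} 0≤a ((b , h) ∷ π) with em {P = a ℚ.≤ b × b ℚ.≤ 1ℚ}
      ... | yes (a≤b , b≤1) = resp
        ((λ (lift h≤ , lift π≤) → lift (a≤b , h≤ , π≤)) ,
         λ (lift (_ , h≤ , π≤)) → lift h≤ , lift π≤)
        (Sets.∩-measurable (Sub S) (piece-measurable 0≤a a≤b b≤1 h)
          (StepBelow-measurable (ℚ.≤-trans 0≤a a≤b) π))
      ... | no ¬a≤b≤1 = Sets.uninhabited (Sub S) λ _ (lift (a≤b , _ , π≤)) →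
        ¬a≤b≤1 (a≤b , StepBelow⇒≤1 π π≤)

      G-measurable : ∀ q → G K A q ∈ 𝓑 (Sub S)
      G-measurable q = resp
        ((λ (π , lift (π≤ , q<π)) → mK , π , π≤ , q<π) ,
         -- A member of `G` brings its own measurability proofs `m`; `ext` exchanges them for `mK`.
         λ {μ} (m , π , π≤ , q<π) → π , lift (StepBelow-mono
           (λ r → proj₁ (Subprobability.ext μ (m r) (mK r) (id , id))) π π≤ , q<π))
        (Sets.⋃-measurable (Sub S) (countable-List (countable-× countable-ℚ countable-ℚ))
          below-measurable)
        where
        below-measurable : ∀ π →
          (λ μ → Lift c (StepBelow (integrand μ) 0ℚ π × q <ᴿ fromℚ (area 0ℚ π))) ∈ 𝓑 (Sub S)
        -- The area does not depend on μ, so this condition either holds throughout or empties the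
        -- set.
        below-measurable π with em {P = q <ᴿ fromℚ (area 0ℚ π)}
        ... | yes q<π = resp ((λ (lift π≤) → lift (π≤ , q<π)) , λ (lift (π≤ , _)) → lift π≤)
                          (StepBelow-measurable ℚ.≤-refl π)
        ... | no  q≮π = Sets.uninhabited (Sub S) λ _ (lift (_ , q<π)) → q≮π q<π

    -- Tameness of the game operations

    G-antitone : ∀ K A {q r} → q ≤ᴿ r → G K A r ⊆ G K A q
    G-antitone K A q≤r (m , π , π≤ , p , p∈π , p∉r) = m , π , π≤ , p , p∈π , p∉r ∘ q≤r p

    𝜷-antitone : ∀ A {q r} → q ≤ᴿ r → 𝜷 S A r ⊆ 𝜷 S A q
    𝜷-antitone A q≤r (mA , p , p∈μA , p∉r) = mA , p , p∈μA , p∉r ∘ q≤r p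

    bare-tame : ∀ γ → Tame (bare γ)
    bare-tame γ .measurable mA q = effectivity-measurable γ (𝜷-measurable mA q)
    bare-tame γ .monotone = inj₁ λ {A} mA {q} {r} q≤r {s} r∈ →
      𝓥.upward (apply (P γ) s) r∈ (λ {μ} → 𝜷-antitone A {q} {r} q≤r {μ})
        (𝜷-measurable mA q)

    -- The result is antitone whatever the direction of `K`: `q` is only a lower bound for the
    -- integral.
    after-tame : ∀ γ {K} → Tame K → Tame (after γ K)
    after-tame γ tame .measurable mA q = effectivity-measurable γ (G-measurable tame mA q)
    after-tame γ {K} tame .monotone = inj₁ λ {A} mA {q} {r} q≤r {s} r∈ →
      𝓥.upward (apply (P γ) s) r∈ (λ {μ} → G-antitone K A {q} {r} q≤r {μ})
        (G-measurable tame mA q)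

    dual-tame : ∀ {K} → Tame K → Tame (dual K)
    dual-tame tame .measurable mA q =
      MeasurableSpace.compl S (measurable tame (MeasurableSpace.compl S mA) q)
    dual-tame tame .monotone = Sum.swap (Sum.map
      (λ antitone mA q≤r s∉ → s∉ ∘ antitone (MeasurableSpace.compl S mA) q≤r)
      (λ isotone mA q≤r s∉ → s∉ ∘ isotone (MeasurableSpace.compl S mA) q≤r)
      (monotone tame))

    -- Only countably many rational pairs occur, and those outside `Q² q` impose no condition.
    -- Raising `q` admits more pairs and so shrinks the set.
    choice-tame : ∀ {K L} → Tame K → Tame L → Tame (choice K L)
    choice-tame {K} {L} tameK tameL .measurable {A} mA q =
      Sets.⋂-measurable S countable-ℚ λ a → Sets.⋂-measurable S countable-ℚ λ b → guarded a b
      where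
      guarded : ∀ a b → (λ s → (a , b) ∈ Q² q → s ∈ (K A (fromℚ a) ∪ L A (fromℚ b))) ∈ 𝓑 S
      guarded a b with em {P = (a , b) ∈ Q² q}
      ... | yes ab∈ = MeasurableSpace.resp S ((λ s∈ _ → s∈) , λ s∈ → s∈ ab∈)
        (Sets.∪-measurable S (measurable tameK mA (fromℚ a)) (measurable tameL mA (fromℚ b)))
      ... | no ab∉ = Sets.universal S λ _ ab∈ → ⊥-elim (ab∉ ab∈)
    choice-tame tameK tameL .monotone = inj₁ λ _ q≤r s∈ a b (0≤a , 0≤b , a+b≤q) →
      s∈ a b (0≤a , 0≤b , λ p → q≤r p ∘ a+b≤q p)

    -- Countable choice and the Souslin operation

    module _ (A : Pred (Carrier S) ℓ) (q : ℝ ℓ) where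

      private
        rational : ℕ → ℚ
        rational = proj₁ countable-ℚ

      -- s lies in all sets scheme K 0ℚ (α|n) iff the sequence a = rational ∘ α
      -- belongs to Q∞ q and s lies in none of the sets K n A (a n).
      scheme : (ℕ → Effect) → ℚ → List ℕ → Pred (Carrier S) ℓ
      scheme K t []      s = fromℚ t ≤ᴿ q
      scheme K t (x ∷ v) s = 0ℚ ℚ.≤ rational x × ¬ (s ∈ K 0 A (fromℚ (rational x))) ×
                             s ∈ scheme (K ∘ suc) (t ℚ.+ rational x) v

      -- The conditions on rationals do not involve the state: each drops out or empties the set.
      -- What remains is a finite intersection of complements.
      scheme-measurable : ∀ K → (∀ n r → K n A r ∈ 𝓑 S) → ∀ t v → scheme K t v ∈ 𝓑 S
      scheme-measurable K mK t [] with em {P = fromℚ t ≤ᴿ q}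
      ... | yes t≤q = Sets.universal S λ _ → t≤q
      ... | no  t≰q = Sets.uninhabited S λ _ → t≰q
      scheme-measurable K mK t (x ∷ v) with em {P = 0ℚ ℚ.≤ rational x}
      ... | yes 0≤x = MeasurableSpace.resp S ((λ s∈ → 0≤x , s∈) , proj₂)
        (Sets.∩-measurable S (MeasurableSpace.compl S (mK 0 (fromℚ (rational x))))
          (scheme-measurable (K ∘ suc) (mK ∘ suc) (t ℚ.+ rational x) v))
      ... | no 0≰x = Sets.uninhabited S λ _ → 0≰x ∘ proj₁

      -- `t` is the sum of the letters already read, and `K` is shifted along with the word, so the
      -- current letter is always tested against `K 0`.
      scheme⇒≤ : ∀ K t {s} α n → s ∈ scheme K t (applyUpTo α n) →
                 fromℚ (t ℚ.+ partialSum (rational ∘ α) n) ≤ᴿ q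
      scheme⇒≤ K t α zero t≤q = subst (λ x → fromℚ x ≤ᴿ q) (sym (ℚ.+-identityʳ t)) t≤q
      scheme⇒≤ K t α (suc n) (_ , _ , s∈) = subst (λ x → fromℚ x ≤ᴿ q)
        (trans (ℚ.+-assoc t _ _) (cong (t ℚ.+_) (sym (partialSum-suc (rational ∘ α) n))))
        (scheme⇒≤ (K ∘ suc) (t ℚ.+ rational (α 0)) (α ∘ suc) n s∈)

      scheme⇒∉ : ∀ K t {s} α n → s ∈ scheme K t (applyUpTo α (suc n)) →
                 0ℚ ℚ.≤ rational (α n) × ¬ (s ∈ K n A (fromℚ (rational (α n))))
      scheme⇒∉ K t α zero    (0≤x , s∉ , _) = 0≤x , s∉
      scheme⇒∉ K t α (suc n) (_ , _ , s∈)   =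
        scheme⇒∉ (K ∘ suc) (t ℚ.+ rational (α 0)) (α ∘ suc) n s∈

      -- One bound suffices for a word of length `n`, because `scheme` tests the accumulated sum
      -- only at the end of the word.
      ∈-scheme : ∀ K t {s} α n → (∀ i → 0ℚ ℚ.≤ rational (α i)) →
                 (∀ i → ¬ (s ∈ K i A (fromℚ (rational (α i))))) →
                 fromℚ (t ℚ.+ partialSum (rational ∘ α) n) ≤ᴿ q →
                 s ∈ scheme K t (applyUpTo α n)
      ∈-scheme K t α zero 0≤ s∉ ≤q = subst (λ x → fromℚ x ≤ᴿ q) (ℚ.+-identityʳ t) ≤q
      ∈-scheme K t α (suc n) 0≤ s∉ ≤q =
        0≤ 0 , s∉ 0 ,
        ∈-scheme (K ∘ suc) (t ℚ.+ rational (α 0)) (α ∘ suc) n (0≤ ∘ suc) (s∉ ∘ suc)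
          (subst (λ x → fromℚ x ≤ᴿ q) (trans (cong (t ℚ.+_) (partialSum-suc (rational ∘ α) n))
            (sym (ℚ.+-assoc t _ _))) ≤q)

      -- A state is outside the set iff some sequence in `Q∞ q` avoids every `K n`. Coding sequences
      -- of rationals by sequences of indices makes these states the result of the Souslin operation
      -- on `scheme`.
      countableChoice-measurable : SouslinClosed S → ∀ K → (∀ n r → K n A r ∈ 𝓑 S) →
                                   countableChoice K A q ∈ 𝓑 S
      countableChoice-measurable souslin K mK = Sets.uncompl S
        (MeasurableSpace.resp S {B = ∁ (countableChoice K A q)} ((λ (α , s∈) s∈* →
            let n , s∈K = s∈* (rational ∘ α)
                  -- The word of length `n + 1` is the first to contain the letter `α n`, while the
                  -- one of length `n` already bounds the sum of the first `n` terms.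
                  ((λ n → proj₁ (scheme⇒∉ K 0ℚ α n (s∈ (suc n)))) ,
                   λ n → subst (λ x → fromℚ x ≤ᴿ q) (ℚ.+-identityˡ _)
                     (scheme⇒≤ K 0ℚ α n (s∈ n)))
            in proj₂ (scheme⇒∉ K 0ℚ α n (s∈ (suc n))) s∈K) ,
         λ s∉* → decidable-stable em λ ¬∃α → s∉* λ a a∈ →
           decidable-stable em λ ¬∃n → ¬∃α (refutation a a∈ ¬∃n))
        (souslin (scheme K 0ℚ) (scheme-measurable K mK 0ℚ)))
        where
        refutation : ∀ {s} a → a ∈ Q∞ q → ¬ (∃ λ n → s ∈ K n A (fromℚ (a n))) →
                     ∃ λ α → ∀ n → s ∈ scheme K 0ℚ (applyUpTo α n)
        refutation {s} a (0≤a , ∑a≤q) ¬∃n = α , λ n → ∈-scheme K 0ℚ α n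
          (λ i → subst (0ℚ ℚ.≤_) (sym (coded i)) (0≤a i))
          (λ i s∈K → ¬∃n (i , subst (λ x → s ∈ K i A (fromℚ x)) (coded i) s∈K))
          (subst (λ x → fromℚ x ≤ᴿ q)
            (sym (trans (ℚ.+-identityˡ _) (partialSum-cong coded n))) (∑a≤q n))
          where
          α : ℕ → ℕ
          α n = proj₁ (proj₂ countable-ℚ (a n))

          coded : ∀ n → rational (α n) ≡ a n
          coded n = proj₂ (proj₂ countable-ℚ (a n))

    countableChoice-tame : SouslinClosed S → ∀ {K} → (∀ n → Tame (K n)) →
                           Tame (countableChoice K)
    countableChoice-tame souslin {K} tame .measurable {A} mA q =
      countableChoice-measurable A q souslin K λ n → measurable (tame n) mA
    countableChoice-tame souslin tame .monotone = inj₁ λ _ q≤r s∈ a (0≤a , ∑a≤q) →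
      s∈ a (0≤a , λ n p → q≤r p ∘ ∑a≤q n p)

  -- Effects are preserved by morphisms

  module Preservation {g c ℓ : Level} {Γ : Set g} {ε : Γ} (𝒢 ℋ : GameFrame Γ ε c ℓ)
    (souslin : SouslinClosed (GameFrame.space ℋ))
    (f : GameFrame.State 𝒢 → GameFrame.State ℋ)
    (mf : Measurable (GameFrame.space 𝒢) (GameFrame.space ℋ) f)
    (morphism : ∀ γ → IsMorphism (GameFrame.P 𝒢 γ) (GameFrame.P ℋ γ) f mf) where

    private
      module 𝒢 = GameFrame 𝒢
      module ℋ = GameFrame ℋ
      module I = Interpretation 𝒢
      module J = Interpretation ℋ

    Preserved : I.Effect → J.Effect → Set (c ⊔ lsuc ℓ)
    Preserved K L = ∀ {A B} → B ∈ 𝓑 ℋ.space → A ≐ (f ⊢ B) → ∀ q → K A q ≐ (f ⊢ L B q)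

    infix 4 _⊑_

    -- Both properties are proved in one induction: tameness over the target gives the measurable
    -- sets at which the morphism condition can be used. Over the source, measurability is obtained
    -- by taking preimages under `f`.
    record _⊑_ (K : I.Effect) (L : J.Effect) : Set (c ⊔ lsuc ℓ) where
      field
        tame      : Tame ℋ L
        preserved : Preserved K L

    open _⊑_

    effectivity-preserved : ∀ γ {W W′} → W′ ∈ 𝓑 (Sub ℋ.space) →
      W ≐ (Sub-map {T = ℋ.space} f mf ⊢ W′) →
      (λ s → W ∈ⱽ apply (𝒢.P γ) s) ≐ (λ s → W′ ∈ⱽ apply (ℋ.P γ) (f s))
    effectivity-preserved γ {W} {W′} mW′ (W⊆ , ⊆W) =
      (λ {s} W∈ → Equivalence.from (morphism γ s W′ mW′)
        (∈ⱽ-resp (apply (𝒢.P γ) s) (W⊆ , ⊆W) W∈)) ,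
      λ {s} W′∈ → ∈ⱽ-resp (apply (𝒢.P γ) s) (⊆W , W⊆)
        (Equivalence.to (morphism γ s W′ mW′) W′∈)

    bare-⊑ : ∀ γ → I.bare γ ⊑ J.bare γ
    bare-⊑ γ .tame = bare-tame ℋ γ
    bare-⊑ γ .preserved {A} {B} mB A≐f⁻¹B q =
      effectivity-preserved γ (𝜷-measurable ℋ mB q)
        ((λ {μ} (mA , p , p∈ , p∉q) →
            mB , p , proj₁ (Subprobability.ext μ mA (mf mB) A≐f⁻¹B) p p∈ , p∉q) ,
         λ {μ} (mB′ , p , p∈ , p∉q) →
            mA , p , proj₂ (Subprobability.ext μ mA (mf mB′) A≐f⁻¹B) p p∈ , p∉q)
      where
      mA = MeasurableSpace.resp 𝒢.space (proj₂ A≐f⁻¹B , proj₁ A≐f⁻¹B) (mf mB)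

    -- The measure of `L B r` under the image of μ is the μ-measure of its preimage, which is
    -- `K A r`. So the same step functions lie below both integrands, and one `G` is the preimage of
    -- the other under `Sub-map`.
    after-⊑ : ∀ γ {K L} → K ⊑ L → I.after γ K ⊑ J.after γ L
    after-⊑ γ e .tame = after-tame ℋ γ (tame e)
    after-⊑ γ {K} {L} e .preserved {A} {B} mB A≐f⁻¹B q =
      effectivity-preserved γ (G-measurable ℋ (tame e) mB q)
        ((λ {μ} (m , π , π≤ , q<π) → mL , π , StepBelow-mono
            (λ r → proj₁ (Subprobability.ext μ (m r) (mf (mL r)) (K≐L r))) π π≤ , q<π) ,
         λ {μ} (m , π , π≤ , q<π) → mK , π , StepBelow-mono
            (λ r → proj₂ (Subprobability.ext μ (mK r) (mf (m r)) (K≐L r))) π π≤ , q<π)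
      where
      K≐L : ∀ (r : 𝕀 ℓ) → K A (value r) ≐ (f ⊢ L B (value r))
      K≐L r = preserved e mB A≐f⁻¹B (value r)

      mL : ∀ (r : 𝕀 ℓ) → L B (value r) ∈ 𝓑 ℋ.space
      mL r = Tame.measurable (tame e) mB (value r)

      mK : ∀ (r : 𝕀 ℓ) → K A (value r) ∈ 𝓑 𝒢.space
      mK r = MeasurableSpace.resp 𝒢.space (proj₂ (K≐L r) , proj₁ (K≐L r)) (mf (mL r))

    dual-⊑ : ∀ {K L} → K ⊑ L → I.dual K ⊑ J.dual L
    dual-⊑ e .tame = dual-tame ℋ (tame e)
    dual-⊑ e .preserved mB (A⊆ , ⊆A) q =
      let K⊆ , ⊆K = preserved e (MeasurableSpace.compl ℋ.space mB)
                      ((λ s∉A → s∉A ∘ ⊆A) , λ s∉B → s∉B ∘ A⊆) q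
      in (λ s∉K → s∉K ∘ ⊆K) , λ s∉L → s∉L ∘ K⊆

    choice-⊑ : ∀ {K K′ L L′} → K ⊑ L → K′ ⊑ L′ → I.choice K K′ ⊑ J.choice L L′
    choice-⊑ e e′ .tame = choice-tame ℋ (tame e) (tame e′)
    choice-⊑ e e′ .preserved mB A≐f⁻¹B q =
      (λ s∈ a b ab∈ → Sum.map (proj₁ (preserved e mB A≐f⁻¹B _))
        (proj₁ (preserved e′ mB A≐f⁻¹B _)) (s∈ a b ab∈)) ,
      λ s∈ a b ab∈ → Sum.map (proj₂ (preserved e mB A≐f⁻¹B _))
        (proj₂ (preserved e′ mB A≐f⁻¹B _)) (s∈ a b ab∈)

    countableChoice-⊑ : ∀ {K L} → (∀ n → K n ⊑ L n) →
                        I.countableChoice K ⊑ J.countableChoice L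
    countableChoice-⊑ e .tame = countableChoice-tame ℋ souslin (tame ∘ e)
    countableChoice-⊑ e .preserved mB A≐f⁻¹B q =
      (λ s∈ a a∈ → let n , s∈K = s∈ a a∈ in n , proj₁ (preserved (e n) mB A≐f⁻¹B _) s∈K) ,
      λ s∈ a a∈ → let n , s∈L = s∈ a a∈ in n , proj₂ (preserved (e n) mB A≐f⁻¹B _) s∈L

    fold-⊑ : ∀ {K L F H} → K ⊑ L → (∀ {K L} → K ⊑ L → F K ⊑ H L) →
             ∀ n → fold K F n ⊑ fold L H n
    fold-⊑ e step zero    = e
    fold-⊑ e step (suc n) = step (fold-⊑ e step n)

    play-⊑ : ∀ τ {K L} → K ⊑ L → I.play τ K ⊑ J.play τ L
    play-⊑ (prim γ)   e = after-⊑ γ e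
    play-⊑ (τ ᵈ)      e = dual-⊑ (play-⊑ τ (dual-⊑ e))
    play-⊑ (τ₁ ∪ᵍ τ₂) e = choice-⊑ (play-⊑ τ₁ e) (play-⊑ τ₂ e)
    play-⊑ (τ₁ ∩ᵍ τ₂) e = dual-⊑ (choice-⊑ (dual-⊑ (play-⊑ τ₁ e)) (dual-⊑ (play-⊑ τ₂ e)))
    play-⊑ (τ₁ ⨾ τ₂)  e = play-⊑ τ₁ (play-⊑ τ₂ e)
    play-⊑ (τ *)      e = countableChoice-⊑ (fold-⊑ e (play-⊑ τ))
    play-⊑ (τ ˣ)      e = dual-⊑ (countableChoice-⊑
      (fold-⊑ (dual-⊑ e) λ e′ → dual-⊑ (play-⊑ τ (dual-⊑ e′))))

    𝔍-⊑ : ∀ τ → I.𝔍 τ ⊑ J.𝔍 τ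
    𝔍-⊑ (prim γ)   = bare-⊑ γ
    𝔍-⊑ (τ ᵈ)      = dual-⊑ (𝔍-⊑ τ)
    𝔍-⊑ (τ₁ ∪ᵍ τ₂) = choice-⊑ (𝔍-⊑ τ₁) (𝔍-⊑ τ₂)
    𝔍-⊑ (τ₁ ∩ᵍ τ₂) = dual-⊑ (choice-⊑ (dual-⊑ (𝔍-⊑ τ₁)) (dual-⊑ (𝔍-⊑ τ₂)))
    𝔍-⊑ (τ₁ ⨾ τ₂)  = play-⊑ τ₁ (𝔍-⊑ τ₂)
    𝔍-⊑ (τ *)      = play-⊑ (τ *) (bare-⊑ ε)
    𝔍-⊑ (τ ˣ)      = dual-⊑ (play-⊑ ((τ ᵈ) *) (bare-⊑ ε))

  -- Validity sets of formulas

  module _ {g p c ℓ : Level} {Γ : Set g} {ε : Γ} {Ψ : Set p} (𝒢 ℋ : GameModel Γ ε Ψ c ℓ)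
           (souslin : SouslinClosed (space ℋ)) (f : ModelMorphism 𝒢 ℋ) where
    open ModelMorphism f
    open Preservation (GameModel.frame 𝒢) (GameModel.frame ℋ) souslin map measurable morphism

    -- Needed in the modal case of `⟦⟧-preserved`, since effects are compared only at measurable
    -- sets of the target.
    ⟦⟧-measurable : ∀ φ → ⟦ φ ⟧ ℋ ∈ 𝓑 (space ℋ)
    ⟦⟧-measurable ⊤ᶠ               = Sets.universal (space ℋ) λ _ → tt
    ⟦⟧-measurable (atom p)         = GameModel.V-measurable ℋ p
    ⟦⟧-measurable (φ ∧ᶠ ψ)         =
      Sets.∩-measurable (space ℋ) (⟦⟧-measurable φ) (⟦⟧-measurable ψ)
    ⟦⟧-measurable (⟨ τ ⟩[ q ] φ) =
      Tame.measurable (_⊑_.tame (𝔍-⊑ τ)) (⟦⟧-measurable φ) (value q)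

    ⟦⟧-preserved : ∀ φ → ⟦ φ ⟧ 𝒢 ≐ (map ⊢ ⟦ φ ⟧ ℋ)
    ⟦⟧-preserved ⊤ᶠ       = id , id
    ⟦⟧-preserved (atom p) = proj₂ (atoms p) , proj₁ (atoms p)
    ⟦⟧-preserved (φ ∧ᶠ ψ) =
      let φ⊆ , ⊆φ = ⟦⟧-preserved φ
          ψ⊆ , ⊆ψ = ⟦⟧-preserved ψ
      in (λ (s∈φ , s∈ψ) → φ⊆ s∈φ , ψ⊆ s∈ψ) , λ (s∈φ , s∈ψ) → ⊆φ s∈φ , ⊆ψ s∈ψ
    ⟦⟧-preserved (⟨ τ ⟩[ q ] φ) =
      _⊑_.preserved (𝔍-⊑ τ) (⟦⟧-measurable φ) (⟦⟧-preserved φ) (value q)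

proposition6p3 : (∀ {a} → ExcludedMiddle a) →
    ∀ {g p c ℓ : Level} {Γ : Set g} {ε : Γ} {Ψ : Set p}
    (𝒢 ℋ : GameModel Γ ε Ψ c ℓ) →
    SouslinClosed (space 𝒢) → SouslinClosed (space ℋ) →
    (f : ModelMorphism 𝒢 ℋ) (φ : Formula Γ Ψ ℓ) (s : State 𝒢) →
    (𝒢 , s ⊨ φ) ⇔ (ℋ , ModelMorphism.map f s ⊨ φ)
proposition6p3 em 𝒢 ℋ _ souslin f φ s =
  let 𝒢⊆ , ℋ⊆ = ⟦⟧-preserved em 𝒢 ℋ souslin f φ in mk⇔ 𝒢⊆ ℋ⊆
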